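{- (a) For all $g\in\mathcal{S}_d^n$ and $0<\delta<1$, there is a $g$-support intersection certification algorithm with one-sided error $\delta$ that makes $\mathbf{R}_{\mathrm{supp}}(g)$ queries. (b) For a fixed $g\in\mathcal{S}_d^n$ and all $f\in\mathbb{R}_{\ge0}[x_1,\ldots,x_n]_d$ given as a black box, there is a deterministic algorithm that decides whether $\mathrm{supp}(g)\cap\mathrm{supp}(f)=\emptyset$ using $\mathbf{R}^+_{\mathrm{supp}}(g)$ queries. (c) For a fixed $g\in\mathbb{R}_{\ge0}[x_1,\ldots,x_n]_d$ and $0\le\varepsilon<1$, and all $f\in\mathbb{R}_{\ge0}[x_1,\ldots,x_n]_d$ given as a black box, there is a deterministic algorithm that computes a $(1\pm\varepsilon)$-approximation to $g(\partial\mathbf{x})f$ using $\mathbf{R}^\varepsilon_{\mathrm{supp}}(g)$ queries.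
   Context: $\mathcal{S}_d^n=\mathbb{C}[x_1,\ldots,x_n]_d$ (homogeneous degree $d$); $\mathbb{R}_{\ge0}[x_1,\ldots,x_n]_d$ is the subset with nonnegative real coefficients. For $f=\sum_\alpha c_\alpha x^\alpha$, $\mathrm{supp}(f)=\{\alpha:c_\alpha\ne0\}$. The Waring rank $\mathbf{R}(g)$ is the minimum $r$ with $g=\ell_1^d+\cdots+\ell_r^d$ for complex linear forms $\ell_i$. Define $\mathbf{R}_{\mathrm{supp}}(f)=\min\{\mathbf{R}(g):g\in\mathcal{S}_d^n,\ \mathrm{supp}(g)=\mathrm{supp}(f)\}$; $\mathbf{R}^+_{\mathrm{supp}}(f)=\min\{\mathbf{R}(g):g\in\mathbb{R}_{\ge0}[x_1,\ldots,x_n]_d,\ \mathrm{supp}(g)=\mathrm{supp}(f)\}$; and, for $f\in\mathbb{R}_{\ge0}[x_1,\ldots,x_n]_d$, $\mathbf{R}^\varepsilon_{\mathrm{supp}}(f)=\min\{\mathbf{R}(g):g\in\mathbb{R}[x_1,\ldots,x_n]_d$ with every coefficient of $g$ between $(1-\varepsilon)$ and $(1+\varepsilon)$ times the corresponding coefficient of $f\}$. $g(\partial\mathbf{x})$ is the differential operator $g(\partial/\partial x_1,\ldots,\partial/\partial x_n)$. A $g$-support intersection certification algorithm with one-sided error $\delta$ is a (randomized) algorithm which, given any $f\in\mathcal{S}_d^n$ as a black box, always outputs "$\mathrm{supp}(f)\cap\mathrm{supp}(g)=\emptyset$" when this holds, and outputs "$\mathrm{supp}(f)\cap\mathrm{supp}(g)\ne\emptyset$"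 with probability at least $1-\delta$ when the intersection is nonempty. A $(1\pm\varepsilon)$-approximation to $N\ge 0$ is a number in $[(1-\varepsilon)N,(1+\varepsilon)N]$. A query is the choice of a point $v\in\mathbb{C}^n$, answered by $f(v)$; arithmetic over $\mathbb{C}$ is exact. -}

module Defs where

open import Algebra.Bundles using (CommutativeRing; RawRing; RawSemiring)
import Algebra.Definitions.RawMonoid as RawMonoidDefs
import Algebra.Definitions.RawSemiring as RawSemiringDefs
open import Axiom.ExcludedMiddle using (ExcludedMiddle)
open import Data.Bool.Base using (if_then_else_)
open import Data.Fin.Base using (Fin)
open import Data.List.Base as List using (List; []; _∷_)
open import Data.Nat.Base as ℕ using (ℕ; zero; suc; NonZero)
import Data.Nat.Properties as ℕ
open import Data.Nat.GeneralisedArithmetic using (fold)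
open import Data.Product.Base using (∃; _×_; _,_)
open import Data.Vec.Base as Vec using (Vec; []; _∷_; lookup; _[_]≔_; _[_]%=_)
open import Data.Vec.Properties using (≡-dec)
open import Level using (0ℓ)
open import Relation.Binary.Core using (Rel)
open import Relation.Binary.PropositionalEquality.Core using (_≡_; _≢_)
open import Relation.Binary.Structures using (IsTotalOrder)
import Relation.Binary.Construct.NonStrictToStrict as ToStrict
open import Relation.Nullary.Decidable.Core using (Dec; yes; no; does)
open import Relation.Nullary.Negation.Core using (¬_)
open import Relation.Unary using (Pred; _∈_; _≐_; _∩_; Empty; Satisfiable)

IsMinimum : Pred ℕ 0ℓ → Pred ℕ 0ℓ
IsMinimum P r = P r × (∀ s → P s → r ℕ.≤ s)

------------------------------------------------------------------------
-- The real numbers, characterised as a Dedekind-complete ordered field.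
-- This determines ℝ up to isomorphism in the presence of excluded middle.

record CompleteOrderedField : Set₁ where
  infix 4 _≤_
  field
    commutativeRing : CommutativeRing 0ℓ 0ℓ

  open CommutativeRing commutativeRing public

  field
    _≤_          : Rel Carrier 0ℓ
    isTotalOrder : IsTotalOrder _≈_ _≤_
    0≉1          : ¬ (0# ≈ 1#)
    inverse      : ∀ x → ¬ (x ≈ 0#) → ∃ λ y → x * y ≈ 1#
    +-monoˡ-≤    : ∀ z {x y} → x ≤ y → x + z ≤ y + z
    *-nonNeg     : ∀ {x y} → 0# ≤ x → 0# ≤ y → 0# ≤ x * y

  IsUpperBound : Pred Carrier 0ℓ → Pred Carrier 0ℓ
  IsUpperBound P u = ∀ x → x ∈ P → x ≤ u

  field
    supremum : (P : Pred Carrier 0ℓ) → Satisfiable P → Satisfiable (IsUpperBound P) →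
               ∃ λ s → IsUpperBound P s × (∀ u → IsUpperBound P u → s ≤ u)

  open ToStrict _≈_ _≤_ public using (_<_)
  open RawMonoidDefs +-rawMonoid public using () renaming (_×_ to _·_)

  fromℕ : ℕ → Carrier
  fromℕ m = m · 1#

------------------------------------------------------------------------
-- Exponent vectors

Exponent : ℕ → Set
Exponent n = Vec ℕ n

𝟎 : ∀ {n} → Exponent n
𝟎 = Vec.replicate _ 0

𝐞 : ∀ {n} → Fin n → Exponent n
𝐞 j = 𝟎 [ j ]≔ 1

below : ∀ {n} → Exponent n → List (Exponent n)
below []      = [] ∷ []
below (c ∷ γ) = List.cartesianProductWith _∷_ (List.upTo (suc c)) (below γ)

monomials : ∀ n → ℕ → List (Exponent n)
monomials n d = List.filter (λ α → Vec.sum α ℕ.≟ d) (below (Vec.replicate n d))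

------------------------------------------------------------------------
-- Polynomial algebra over a ring

module Polynomials (R : RawRing 0ℓ 0ℓ) where
  open RawRing R
  open RawSemiringDefs rawSemiring using (_^_) renaming (_×_ to _·_)

  ∑ : {A : Set} → List A → (A → Carrier) → Carrier
  ∑ xs f = List.foldr _+_ 0# (List.map f xs)

  -- Coefficient families. No finiteness is imposed at this stage (the product
  -- does not need it); forms, below, have finite support by homogeneity.

  Series : ℕ → Set
  Series n = Exponent n → Carrier

  X^ : ∀ {n} → Exponent n → Series n
  X^ β α = if does (≡-dec ℕ._≟_ α β) then 1# else 0#

  series : ℕ → RawSemiring 0ℓ 0ℓ
  series n = record
    { Carrier = Series n
    ; _≈_     = λ p q → ∀ α → p α ≈ q α
    ; _+_     = λ p q α → p α + q α
    ; _*_     = λ p q γ → ∑ (below γ) λ α → p α * q (Vec.zipWith ℕ._∸_ γ α)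
    ; 0#      = λ _ → 0#
    ; 1#      = X^ 𝟎
    }

  module Ser {n} = RawSemiring (series n)
  module SerDefs {n} = RawSemiringDefs (series n)

  _•_ : ∀ {n} → Carrier → Series n → Series n
  (c • p) α = c * p α

  linearForm : ∀ {n} → Vec Carrier n → Series n
  linearForm c = SerDefs.sum λ j → lookup c j • X^ (𝐞 j)

  ∂ : ∀ {n} → Fin n → Series n → Series n
  ∂ j p α = suc (lookup α j) · p (α [ j ]%= suc)

  ∂^ : ∀ {n} → Exponent n → Series n → Series n
  ∂^ {n} α p = List.foldr (λ j q → fold q (∂ j) (lookup α j)) p (List.allFin n)

  record Form (n d : ℕ) : Set where
    field
      coeff       : Series n
      homogeneous : ∀ α → Vec.sum α ≢ d → coeff α ≈ 0#
  open Form public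

  supp : ∀ {n d} → Form n d → Pred (Exponent n) 0ℓ
  supp f α = ¬ (coeff f α ≈ 0#)

  eval : ∀ {n d} → Form n d → Vec Carrier n → Carrier
  eval {n} {d} f v = ∑ (monomials n d) λ α →
    coeff f α * Vec.foldr′ _*_ 1# (Vec.zipWith _^_ v α)

  -- g(∂𝐱)f has degree 0 when f and g have the same degree, so it is
  -- identified with its constant coefficient.

  _⟨∂⟩_ : ∀ {n d} → Form n d → Form n d → Carrier
  _⟨∂⟩_ {n} {d} g f = List.foldr Ser._+_ Ser.0#
    (List.map (λ α → coeff g α • ∂^ α (coeff f)) (monomials n d)) 𝟎

------------------------------------------------------------------------

module Theory (em : ExcludedMiddle 0ℓ) (real : CompleteOrderedField) where

  module ℝ = CompleteOrderedField real

  ℝ : Set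
  ℝ = ℝ.Carrier

  record ℂ : Set where
    constructor _+i_
    field
      re im : ℝ
  open ℂ public

  ℂ-rawRing : RawRing 0ℓ 0ℓ
  ℂ-rawRing = record
    { Carrier = ℂ
    ; _≈_     = λ z w → re z ℝ.≈ re w × im z ℝ.≈ im w
    ; _+_     = λ z w → (re z ℝ.+ re w) +i (im z ℝ.+ im w)
    ; _*_     = λ z w → (re z ℝ.* re w ℝ.- im z ℝ.* im w) +i
                        (re z ℝ.* im w ℝ.+ im z ℝ.* re w)
    ; -_      = λ z → (ℝ.- re z) +i (ℝ.- im z)
    ; 0#      = ℝ.0# +i ℝ.0#
    ; 1#      = ℝ.1# +i ℝ.0#
    }

  module ℂ-Ring = RawRing ℂ-rawRing
  open Polynomials ℂ-rawRing public

  fromℝ : ℝ → ℂ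
  fromℝ x = x +i ℝ.0#

  IsReal : Pred ℂ 0ℓ
  IsReal z = im z ℝ.≈ ℝ.0#

  IsNonNegative : Pred ℂ 0ℓ
  IsNonNegative z = IsReal z × ℝ.0# ℝ.≤ re z

  -- z is a real number in [(1-ε)N , (1+ε)N], for N real and nonnegative.

  Approximates : ℝ → ℂ → Pred ℂ 0ℓ
  Approximates ε N z = IsReal z
    × (ℝ.1# ℝ.- ε) ℝ.* re N ℝ.≤ re z
    × re z ℝ.≤ (ℝ.1# ℝ.+ ε) ℝ.* re N

  RealForm : ∀ {n d} → Pred (Form n d) 0ℓ
  RealForm f = ∀ α → IsReal (coeff f α)

  NonNegativeForm : ∀ {n d} → Pred (Form n d) 0ℓ
  NonNegativeForm f = ∀ α → IsNonNegative (coeff f α)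

  ----------------------------------------------------------------------
  -- Waring and support ranks. A rank is a minimum over a possibly empty set
  -- (e.g. the constant 1/2 in degree 0 is not a sum of 0-th powers), so
  -- "the rank is r" is a relation; it holds for no r when the set is empty.

  HasWaringDecomposition : ∀ {n d} → Form n d → Pred ℕ 0ℓ
  HasWaringDecomposition {n} {d} g r = ∃ λ (ℓ : Fin r → Vec ℂ n) →
    coeff g Ser.≈ SerDefs.sum (λ i → linearForm (ℓ i) SerDefs.^ d)

  IsWaringRank : ∀ {n d} → Form n d → Pred ℕ 0ℓ
  IsWaringRank g = IsMinimum (HasWaringDecomposition g)

  IsSupportRank : ∀ {n d} → Form n d → Pred ℕ 0ℓ
  IsSupportRank {n} {d} f = IsMinimum λ r → ∃ λ (g : Form n d) →
    supp g ≐ supp f × IsWaringRank g r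

  IsNonNegativeSupportRank : ∀ {n d} → Form n d → Pred ℕ 0ℓ
  IsNonNegativeSupportRank {n} {d} f = IsMinimum λ r → ∃ λ (g : Form n d) →
    NonNegativeForm g × supp g ≐ supp f × IsWaringRank g r

  IsApproximateSupportRank : ∀ {n d} → ℝ → Form n d → Pred ℕ 0ℓ
  IsApproximateSupportRank {n} {d} ε f = IsMinimum λ r → ∃ λ (g : Form n d) →
    RealForm g × (∀ α → Approximates ε (coeff f α) (coeff g α)) × IsWaringRank g r

  ----------------------------------------------------------------------
  -- Black-box algorithms: algebraic decision trees over ℂ with exact
  -- arithmetic, equality tests and adaptive queries. Division and order
  -- tests are not offered; they would only enlarge the class of algorithms.

  data Expr (k : ℕ) : Set where
    con     : ℂ → Expr k
    var     : Fin k → Expr k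
    _⊕_ _⊗_ : Expr k → Expr k → Expr k
    ⊝_      : Expr k → Expr k

  ⟦_⟧ : ∀ {k} → Expr k → Vec ℂ k → ℂ
  ⟦ con c ⟧ ρ = c
  ⟦ var i ⟧ ρ = lookup ρ i
  ⟦ a ⊕ b ⟧ ρ = ⟦ a ⟧ ρ ℂ-Ring.+ ⟦ b ⟧ ρ
  ⟦ a ⊗ b ⟧ ρ = ⟦ a ⟧ ρ ℂ-Ring.* ⟦ b ⟧ ρ
  ⟦ ⊝ a   ⟧ ρ = ℂ-Ring.- ⟦ a ⟧ ρ

  -- Tree n Out k q: k answers have been received so far (most recent first)
  -- and q further queries are made along every branch.

  data Tree (n : ℕ) (Out : ℕ → Set) : ℕ → ℕ → Set where
    return : ∀ {k} → Out k → Tree n Out k 0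
    query  : ∀ {k q} → Vec (Expr k) n → Tree n Out (suc k) q → Tree n Out k (suc q)
    ifZero : ∀ {k q} → Expr k → (yes no : Tree n Out k q) → Tree n Out k q

  run : ∀ {n Out k q} {A : Set} → (∀ {m} → Out m → Vec ℂ m → A) →
        (oracle : Vec ℂ n → ℂ) → Tree n Out k q → Vec ℂ k → A
  run out oracle (return o)     ρ = out o ρ
  run out oracle (query v t)    ρ =
    run out oracle t (oracle (Vec.map (λ e → ⟦ e ⟧ ρ) v) ∷ ρ)
  run out oracle (ifZero e t u) ρ with em {⟦ e ⟧ ρ ℂ-Ring.≈ ℂ-Ring.0#}
  ... | yes _ = run out oracle t ρ
  ... | no  _ = run out oracle u ρ

  data Verdict : Set where
    disjoint intersecting : Verdict

  DecisionAlgorithm : (n q : ℕ) → Set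
  DecisionAlgorithm n q = Tree n (λ _ → Verdict) 0 q

  decide : ∀ {n d q} → DecisionAlgorithm n q → Form n d → Verdict
  decide t f = run (λ o _ → o) (eval f) t []

  NumericAlgorithm : (n q : ℕ) → Set
  NumericAlgorithm n q = Tree n Expr 0 q

  compute : ∀ {n d q} → NumericAlgorithm n q → Form n d → ℂ
  compute t f = run ⟦_⟧ (eval f) t []

  -- A deterministic algorithm chosen by a uniformly random seed.

  record RandomizedAlgorithm (n q : ℕ) : Set where
    field
      seeds         : ℕ
      seeds-nonZero : NonZero seeds
      algorithm     : Fin seeds → DecisionAlgorithm n q
  open RandomizedAlgorithm public

  count : ∀ {m} → Pred (Fin m) 0ℓ → ℕ
  count {m} E = List.length (List.filter (λ ω → em {E ω}) (List.allFin m))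

  -- For ω uniform on Fin m (m ≠ 0): p ≤ Pr[ E ω ] = count E / m.

  ProbabilityAtLeast : ∀ {m} → ℝ → Pred (Fin m) 0ℓ → Set
  ProbabilityAtLeast {m} p E = p ℝ.* ℝ.fromℕ m ℝ.≤ ℝ.fromℕ (count E)

  CertifiesSupportIntersection : ∀ {n d q} → Form n d → ℝ → RandomizedAlgorithm n q → Set
  CertifiesSupportIntersection {n} {d} g δ 𝒜 = (f : Form n d) →
    (Empty (supp f ∩ supp g) → ∀ ω → decide (algorithm 𝒜 ω) f ≡ disjoint) ×
    (Satisfiable (supp f ∩ supp g) →
      ProbabilityAtLeast (ℝ.1# ℝ.- δ) λ ω → decide (algorithm 𝒜 ω) f ≡ intersecting)

{-# OPTIONS --safe #-}

-- If g = ℓ₁^d + ⋯ + ℓᵣ^d, then d! (f(ℓ₁) + ⋯ + f(ℓᵣ)) = g(∂)f = Σ_α α! g_α f_α (apolarity), so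
-- r queries evaluate this sum. A form with nonnegative coefficients makes every term
-- nonnegative, which gives (b), and perturbing the coefficients of g within a factor 1 ± ε
-- perturbs every term within that factor, which gives (c). For (a), the terms are kept from
-- cancelling by substituting xⱼ ↦ tⱼ xⱼ in f: the sum becomes a polynomial in t with coefficients
-- α! g_α f_α. A Kronecker substitution tⱼ = s^{B^(n-j)}, with B = d + 1, makes it univariate
-- without merging terms, so it has fewer than Bⁿ roots s if it is not zero, and s is drawn from
-- {0, …, m - 1} with m δ ≥ Bⁿ.

module Submission where

open import Defs
open import Algebra.Bundles using (CommutativeRing; RawRing)
open import Algebra.Structures using (IsCommutativeRing)
open import Axiom.ExcludedMiddle using (ExcludedMiddle)
open import Data.Fin.Base as Fin using (Fin; zero; suc; toℕ)
import Data.Fin.Properties as Fin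
open import Data.List.Base as List using (List; []; _∷_; _++_; length)
open import Data.List.Membership.Propositional using () renaming (_∈_ to _∈ˡ_; _∉_ to _∉ˡ_)
import Data.List.Membership.Propositional.Properties as ∈ˡ
import Data.List.Properties as List
open import Data.List.Relation.Unary.All as All using (All; []; _∷_)
import Data.List.Relation.Unary.All.Properties as All
open import Data.List.Relation.Unary.AllPairs as AllPairs using (AllPairs; []; _∷_)
import Data.List.Relation.Unary.AllPairs.Properties as AllPairs
open import Data.List.Relation.Unary.Any using (here; there)
open import Data.List.Relation.Unary.Unique.Propositional using (Unique)
import Data.List.Relation.Unary.Unique.Propositional.Properties as Unique
open import Data.Nat.Base as ℕ using (ℕ; zero; suc; _!; z≤n; s≤s)
open import Data.Nat.GeneralisedArithmetic using (fold)
import Data.Nat.Properties as ℕ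
open import Data.Product.Base using (∃; _×_; _,_; proj₁; proj₂)
open import Data.Sum.Base using (inj₁; inj₂)
open import Data.Vec.Base as Vec using (Vec; []; _∷_; lookup; _[_]%=_)
import Data.Vec.Properties as Vec
open import Function.Base using (_∘_; id)
open import Function.Bundles using (_⇔_; mk⇔; Equivalence)
open import Level using (0ℓ)
open import Relation.Binary.Bundles using (Preorder)
open import Relation.Binary.PropositionalEquality as ≡ using (_≡_; _≢_; refl; cong; cong₂)
open import Relation.Binary.Structures using (IsTotalOrder)
open import Relation.Nullary.Decidable.Core using (yes; no; ¬?)
open import Relation.Nullary.Negation.Core using (¬_; contradiction)
open import Relation.Unary using (Pred; _∈_; _∩_; Decidable; Empty; Satisfiable)

-- The queried points come from a decomposition of a form g′ attaining the rank, not of g, so the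
-- argument must survive the passage from g to g′. In (a) and (b) g′ shares the support of g, which
-- decides whether each single term vanishes; in (c) the weights α! f_α are nonnegative, so
-- coefficientwise bounds add up. Over ℂ the terms can cancel although the supports meet, and this
-- is what the randomness is for. The substitution costs no queries: f(t₁x₁, ..., tₙxₙ) at ℓᵢ is f
-- at the entrywise product of t and ℓᵢ, so a seed merely moves the r points. If the supports are
-- disjoint, every coefficient of the polynomial in s is 0 and no seed can err. Apolarity is proved
-- over any commutative ring, with factorials kept as integer multiples; they are cancelled only
-- once the ring is ℂ, where the order on ℝ gives characteristic 0.

-- Exponent vectors, their factorials and boxes

_!ᵛ : ∀ {n} → Exponent n → ℕ
α !ᵛ = Vec.foldr′ ℕ._*_ 1 (Vec.map _! α)

decr : ∀ {n} → Exponent n → Fin n → Exponent n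
decr γ j = γ [ j ]%= ℕ.pred

sum-𝟎 : ∀ {n} (α : Exponent n) → Vec.sum α ≡ 0 → α ≡ 𝟎
sum-𝟎 []         _ = refl
sum-𝟎 (zero ∷ α) p = cong (0 ∷_) (sum-𝟎 α p)

𝟎-! : ∀ n → 𝟎 {n} !ᵛ ≡ 1
𝟎-! zero    = refl
𝟎-! (suc n) = ≡.trans (ℕ.*-identityˡ _) (𝟎-! n)

∸-𝟎 : ∀ {n} (γ : Exponent n) → Vec.zipWith ℕ._∸_ γ 𝟎 ≡ γ
∸-𝟎 []      = refl
∸-𝟎 (c ∷ γ) = cong (c ∷_) (∸-𝟎 γ)

∸-𝐞 : ∀ {n} (γ : Exponent n) j → Vec.zipWith ℕ._∸_ γ (𝐞 j) ≡ decr γ j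
∸-𝐞 (zero  ∷ γ) zero    = cong (_ ∷_) (∸-𝟎 γ)
∸-𝐞 (suc c ∷ γ) zero    = cong (_ ∷_) (∸-𝟎 γ)
∸-𝐞 (c ∷ γ)     (suc j) = cong (c ∷_) (∸-𝐞 γ j)

-- The entry must be positive: at a zero entry the right side would be 0 while γ! never is.
decr-! : ∀ {n} (γ : Exponent n) j {a} → lookup γ j ≡ suc a → γ !ᵛ ≡ lookup γ j ℕ.* decr γ j !ᵛ
decr-! (suc c ∷ γ) zero    refl = ℕ.*-assoc (suc c) (c !) (γ !ᵛ)
decr-! (c ∷ γ)     (suc j) p    = begin
  c ! ℕ.* γ !ᵛ                            ≡⟨ cong (c ! ℕ.*_) (decr-! γ j p) ⟩
  c ! ℕ.* (lookup γ j ℕ.* decr γ j !ᵛ)    ≡⟨ ℕ.*-comm (c !) _ ⟩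
  lookup γ j ℕ.* decr γ j !ᵛ ℕ.* c !      ≡⟨ ℕ.*-assoc (lookup γ j) _ _ ⟩
  lookup γ j ℕ.* (decr γ j !ᵛ ℕ.* c !)    ≡⟨ cong (lookup γ j ℕ.*_) (ℕ.*-comm _ (c !)) ⟩
  lookup γ j ℕ.* (c ! ℕ.* decr γ j !ᵛ)    ∎
  where open ≡.≡-Reasoning

decr-sum : ∀ {n} (γ : Exponent n) j {a} → lookup γ j ≡ suc a → Vec.sum γ ≡ suc (Vec.sum (decr γ j))
decr-sum (suc c ∷ γ) zero    refl = refl
decr-sum (c ∷ γ)     (suc j) p    = ≡.trans (cong (c ℕ.+_) (decr-sum γ j p)) (ℕ.+-suc c _)

∈-below⁺ : ∀ {n} {α : Exponent n} γ → (∀ j → lookup α j ℕ.≤ lookup γ j) → α ∈ˡ below γ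
∈-below⁺ {α = []}    []      _ = here refl
∈-below⁺ {α = a ∷ α} (c ∷ γ) p =
  ∈ˡ.∈-cartesianProductWith⁺ _∷_ (∈ˡ.∈-upTo⁺ (s≤s (p zero))) (∈-below⁺ γ (p ∘ suc))

∈-below⁻ : ∀ {n} {α : Exponent n} γ → α ∈ˡ below γ → ∀ j → lookup α j ℕ.≤ lookup γ j
∈-below⁻ (c ∷ γ) p j with ∈ˡ.∈-cartesianProductWith⁻ _∷_ (List.upTo (suc c)) (below γ) p
∈-below⁻ (c ∷ γ) p zero    | a , α , a∈ , α∈ , refl = ℕ.s≤s⁻¹ (∈ˡ.∈-upTo⁻ a∈)
∈-below⁻ (c ∷ γ) p (suc j) | a , α , a∈ , α∈ , refl = ∈-below⁻ γ α∈ j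

below-unique : ∀ {n} (γ : Exponent n) → Unique (below γ)
below-unique []      = [] ∷ []
below-unique (c ∷ γ) =
  Unique.cartesianProductWith⁺ _∷_ Vec.∷-injective (Unique.upTo⁺ (suc c)) (below-unique γ)

-- With `𝐞∉below`, this decides whether the variable xⱼ can be split off from the monomial with
-- exponent γ, that is, whether `𝐞 j` occurs in the convolution for a product with xⱼ.
𝐞∈below : ∀ {n} (γ : Exponent n) j {a} → lookup γ j ≡ suc a → 𝐞 j ∈ˡ below γ
𝐞∈below γ j p = ∈-below⁺ γ (le γ j p)
  where
  le : ∀ {n} (γ : Exponent n) j {a} → lookup γ j ≡ suc a → ∀ i → lookup (𝐞 j) i ℕ.≤ lookup γ i
  le (_ ∷ γ) zero    refl zero    = s≤s z≤n
  le (_ ∷ γ) zero    refl (suc i) = ℕ.≤-trans (ℕ.≤-reflexive (Vec.lookup-replicate i 0)) z≤n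
  le (_ ∷ γ) (suc j) p    zero    = z≤n
  le (_ ∷ γ) (suc j) p    (suc i) = le γ j p i

𝐞∉below : ∀ {n} (γ : Exponent n) j → lookup γ j ≡ 0 → 𝐞 j ∉ˡ below γ
𝐞∉below γ j p e∈ =
  ℕ.<⇒≢ (≡.subst₂ ℕ._≤_ (Vec.lookup∘updateAt j 𝟎) p (∈-below⁻ γ e∈ j)) refl

entries≤sum : ∀ {n} (α : Exponent n) j → lookup α j ℕ.≤ Vec.sum α
entries≤sum (a ∷ α) zero    = ℕ.m≤m+n a _
entries≤sum (a ∷ α) (suc j) = ℕ.≤-trans (entries≤sum α j) (ℕ.m≤n+m _ a)

∈-box : ∀ {n d} {α : Exponent n} → Vec.sum α ≡ d → α ∈ˡ below (Vec.replicate n d)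
∈-box {d = d} {α} refl = ∈-below⁺ (Vec.replicate _ d) λ j →
  ℕ.≤-trans (entries≤sum α j) (ℕ.≤-reflexive (≡.sym (Vec.lookup-replicate j d)))

∈-monomials⁺ : ∀ {n d} {α : Exponent n} → Vec.sum α ≡ d → α ∈ˡ monomials n d
∈-monomials⁺ p = ∈ˡ.∈-filter⁺ (λ α → Vec.sum α ℕ.≟ _) (∈-box p) p

∈-monomials⁻ : ∀ n d {α : Exponent n} → α ∈ˡ monomials n d → Vec.sum α ≡ d
∈-monomials⁻ n d p = proj₂ (∈ˡ.∈-filter⁻ (λ α → Vec.sum α ℕ.≟ d) {xs = below (Vec.replicate n d)} p)

-- Powers of linear forms, derivatives and apolarity over a commutative ring

module Apolarity (K : CommutativeRing 0ℓ 0ℓ) where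
  open CommutativeRing K hiding (zero) renaming (refl to ≈-refl; sym to ≈-sym; trans to ≈-trans)
  open Polynomials rawRing
  open import Algebra.Definitions.RawSemiring (RawRing.rawSemiring rawRing) using (_^_; sum)
    renaming (_×_ to infixr 7 _·_)
  open import Algebra.Properties.Semiring.Sum semiring using (sum-cong-≋; *-distribˡ-sum)
  open import Algebra.Properties.CommutativeMonoid.Mult +-commutativeMonoid
    using (×-congʳ; ×-congˡ; ×-homo-1; ×-homo-+; ×-assocˡ; ×-distrib-+)
  open import Algebra.Properties.Semiring.Mult semiring using (×-comm-*; ×-assoc-*)
  open import Algebra.Properties.CommutativeSemigroup *-commutativeSemigroup using (x∙yz≈y∙xz)
  open import Algebra.Properties.CommutativeSemigroup +-commutativeSemigroup using (interchange)
  open import Relation.Binary.Reasoning.Setoid setoid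

  ∑-cong : ∀ {A : Set} (xs : List A) {f g : A → Carrier} →
           (∀ {x} → x ∈ˡ xs → f x ≈ g x) → ∑ xs f ≈ ∑ xs g
  ∑-cong []       eq = ≈-refl
  ∑-cong (x ∷ xs) eq = +-cong (eq (here refl)) (∑-cong xs (eq ∘ there))

  ∑-zero : ∀ {A : Set} (xs : List A) {f : A → Carrier} → (∀ {x} → x ∈ˡ xs → f x ≈ 0#) → ∑ xs f ≈ 0#
  ∑-zero []       eq = ≈-refl
  ∑-zero (x ∷ xs) eq =
    ≈-trans (+-cong (eq (here refl)) (∑-zero xs (eq ∘ there))) (+-identityˡ 0#)

  ∑-distrib-+ : ∀ {A : Set} (xs : List A) (f g : A → Carrier) →
                ∑ xs (λ x → f x + g x) ≈ ∑ xs f + ∑ xs g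
  ∑-distrib-+ []       f g = ≈-sym (+-identityˡ 0#)
  ∑-distrib-+ (x ∷ xs) f g =
    ≈-trans (+-congˡ (∑-distrib-+ xs f g)) (interchange _ _ _ _)

  *-distribˡ-∑ : ∀ {A : Set} (xs : List A) c (f : A → Carrier) → c * ∑ xs f ≈ ∑ xs (λ x → c * f x)
  *-distribˡ-∑ []       c f = zeroʳ c
  *-distribˡ-∑ (x ∷ xs) c f = ≈-trans (distribˡ c _ _) (+-congˡ (*-distribˡ-∑ xs c f))

  ∑-sum-comm : ∀ {A : Set} {r} (xs : List A) (f : Fin r → A → Carrier) →
               ∑ xs (λ x → sum λ i → f i x) ≈ sum (λ i → ∑ xs (f i))
  ∑-sum-comm {r = zero}  xs f = ∑-zero xs λ _ → ≈-refl
  ∑-sum-comm {r = suc r} xs f =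
    ≈-trans (∑-distrib-+ xs _ _) (+-congˡ (∑-sum-comm xs (f ∘ suc)))

  -- Extends a sum over the monomials of degree d to the whole box, which the Kronecker substitution
  -- enumerates.
  ∑-filter : ∀ {A : Set} {P : Pred A 0ℓ} (P? : Decidable P) (xs : List A) {f : A → Carrier} →
             (∀ x → ¬ P x → f x ≈ 0#) → ∑ (List.filter P? xs) f ≈ ∑ xs f
  ∑-filter P? []       z = ≈-refl
  ∑-filter P? (x ∷ xs) z with P? x
  ... | yes _ = +-congˡ (∑-filter P? xs z)
  ... | no ¬p = ≈-trans (∑-filter P? xs z) (≈-sym (≈-trans (+-congʳ (z x ¬p)) (+-identityˡ _)))

  X^-≡ : ∀ {n} (β : Exponent n) → X^ β β ≡ 1#
  X^-≡ β with Vec.≡-dec ℕ._≟_ β β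
  ... | yes _ = refl
  ... | no ≢  = contradiction refl ≢

  X^-≢ : ∀ {n} {β α : Exponent n} → α ≢ β → X^ β α ≡ 0#
  X^-≢ {β = β} {α} α≢β with Vec.≡-dec ℕ._≟_ α β
  ... | yes eq = contradiction eq α≢β
  ... | no _   = refl

  X^-∉ : ∀ {n} {β α : Exponent n} {xs} (f : Exponent n → Carrier) → β ∉ˡ xs → α ∈ˡ xs → X^ β α * f α ≈ 0#
  X^-∉ {β = β} {α} f β∉ α∈ = begin
    X^ β α * f α ≡⟨ cong (_* f α) (X^-≢ {β = β} {α} λ { refl → β∉ α∈ }) ⟩
    0# * f α     ≈⟨ zeroˡ _ ⟩
    0#           ∎

  ∑-X^ : ∀ {n} {β : Exponent n} {xs} (f : Exponent n → Carrier) → Unique xs → β ∈ˡ xs →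
         ∑ xs (λ α → X^ β α * f α) ≈ f β
  ∑-X^ {β = β} {_ ∷ xs} f u@(_ ∷ _) (here refl) = begin
    X^ β β * f β + ∑ xs _ ≈⟨ +-cong (*-congʳ (reflexive (X^-≡ β)))
                                    (∑-zero xs (X^-∉ f (Unique.Unique[x∷xs]⇒x∉xs u))) ⟩
    1# * f β + 0#         ≈⟨ +-identityʳ _ ⟩
    1# * f β              ≈⟨ *-identityˡ _ ⟩
    f β                   ∎
  ∑-X^ {β = β} {α ∷ xs} f (α≢ ∷ u) (there β∈) = begin
    X^ β α * f α + ∑ xs _ ≈⟨ +-cong (*-congʳ (reflexive (X^-≢ (All.lookup α≢ β∈)))) (∑-X^ f u β∈) ⟩
    0# * f α + f β        ≈⟨ +-congʳ (zeroˡ _) ⟩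
    0# + f β              ≈⟨ +-identityˡ _ ⟩
    f β                   ∎

  sum-coeff : ∀ {n r} (p : Fin r → Series n) α → SerDefs.sum p α ≡ sum (λ i → p i α)
  sum-coeff {r = zero}  p α = refl
  sum-coeff {r = suc r} p α = cong (p zero α +_) (sum-coeff (p ∘ suc) α)

  -- Literally the factor that occurs in `eval`, so that `eval` unfolds to a sum of coefficients
  -- times `monomial`.
  monomial : ∀ {n} → Vec Carrier n → Exponent n → Carrier
  monomial v α = Vec.foldr′ _*_ 1# (Vec.zipWith _^_ v α)

  monomial-𝟎 : ∀ {n} (v : Vec Carrier n) → monomial v 𝟎 ≈ 1#
  monomial-𝟎 []      = ≈-refl
  monomial-𝟎 (_ ∷ v) = ≈-trans (*-identityˡ _) (monomial-𝟎 v)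

  monomial-decr : ∀ {n} (v : Vec Carrier n) γ j {a} → lookup γ j ≡ suc a →
                  lookup v j * monomial v (decr γ j) ≈ monomial v γ
  monomial-decr (x ∷ v) (suc c ∷ γ) zero    refl = ≈-sym (*-assoc _ _ _)
  monomial-decr (x ∷ v) (c ∷ γ)     (suc j) p    =
    ≈-trans (x∙yz≈y∙xz _ _ _) (*-congˡ (monomial-decr v γ j p))

  -- Distributing the convolution over the variables leaves inner sums with at most one nonzero
  -- term, the one at β = `𝐞 j`.
  linearForm-* : ∀ {n} (c : Vec Carrier n) (p : Series n) γ →
    (linearForm c Ser.* p) γ ≈
    sum (λ j → lookup c j * ∑ (below γ) (λ β → X^ (𝐞 j) β * p (Vec.zipWith ℕ._∸_ γ β)))
  linearForm-* {n} c p γ = begin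
    ∑ (below γ) (λ β → linearForm c β * q β)
      ≈⟨ ∑-cong (below γ) (λ {β} _ → step β) ⟩
    ∑ (below γ) (λ β → sum λ j → lookup c j * (X^ (𝐞 j) β * q β))
      ≈⟨ ∑-sum-comm {r = n} (below γ) _ ⟩
    sum (λ j → ∑ (below γ) λ β → lookup c j * (X^ (𝐞 j) β * q β))
      ≈⟨ sum-cong-≋ {n} (λ j → ≈-sym (*-distribˡ-∑ (below γ) _ _)) ⟩
    sum (λ j → lookup c j * ∑ (below γ) (λ β → X^ (𝐞 j) β * q β)) ∎
    where
    q : Series _
    q β = p (Vec.zipWith ℕ._∸_ γ β)
    step : ∀ β → linearForm c β * q β ≈ sum (λ j → lookup c j * (X^ (𝐞 j) β * q β))
    step β = begin
      linearForm c β * q β                          ≈⟨ *-comm _ _ ⟩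
      q β * linearForm c β                          ≡⟨ cong (q β *_) (sum-coeff (λ j → lookup c j • X^ (𝐞 j)) β) ⟩
      q β * sum (λ j → lookup c j * X^ (𝐞 j) β)     ≈⟨ *-distribˡ-sum (q β) (λ j → lookup c j * X^ (𝐞 j) β) ⟩
      sum (λ j → q β * (lookup c j * X^ (𝐞 j) β))
        ≈⟨ sum-cong-≋ {n} (λ j → ≈-trans (*-comm _ _) (*-assoc _ _ _)) ⟩
      sum (λ j → lookup c j * (X^ (𝐞 j) β * q β))   ∎

  ·-sum : ∀ {n} k (f : Fin n → Carrier) → k · sum f ≈ sum (λ j → k · f j)
  ·-sum {zero}  zero    f = ≈-refl
  ·-sum {zero}  (suc k) f = ≈-trans (+-identityˡ _) (·-sum k f)
  ·-sum {suc n} k       f = ≈-trans (×-distrib-+ _ _ k) (+-congˡ (·-sum k (f ∘ suc)))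

  -- Supplies the factor d + 1 that turns d! into (d + 1)! in `linearForm-^`.
  sum-lookup-· : ∀ {n} (γ : Exponent n) z → sum (λ j → lookup γ j · z) ≈ Vec.sum γ · z
  sum-lookup-· []      z = ≈-refl
  sum-lookup-· (c ∷ γ) z = ≈-trans (+-congˡ (sum-lookup-· γ z)) (≈-sym (×-homo-+ z c (Vec.sum γ)))

  -- The multinomial theorem, with α! moved to the left so that no division occurs.
  linearForm-^ : ∀ {n} d (c : Vec Carrier n) α → Vec.sum α ≡ d →
                 α !ᵛ · (linearForm c SerDefs.^ d) α ≈ d ! · monomial c α
  linearForm-^ {n} zero c α |α|≡0 with sum-𝟎 α |α|≡0
  ... | refl = begin
    𝟎 {n} !ᵛ · X^ 𝟎 (𝟎 {n}) ≡⟨ cong₂ _·_ (𝟎-! n) (X^-≡ (𝟎 {n})) ⟩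
    1 · 1#              ≈⟨ ×-congʳ 1 (monomial-𝟎 c) ⟨
    1 · monomial c 𝟎    ∎
  linearForm-^ {n} (suc d) c γ |γ|≡1+d = begin
    γ !ᵛ · (linearForm c Ser.* p) γ                     ≈⟨ ×-congʳ (γ !ᵛ) (linearForm-* c p γ) ⟩
    γ !ᵛ · sum (λ j → lookup c j * shifted j)           ≈⟨ ·-sum {n} (γ !ᵛ) _ ⟩
    sum (λ j → γ !ᵛ · (lookup c j * shifted j))         ≈⟨ sum-cong-≋ {n} (λ j → term j _ refl) ⟩
    sum (λ j → lookup γ j · (d ! · monomial c γ))       ≈⟨ sum-lookup-· γ _ ⟩
    Vec.sum γ · (d ! · monomial c γ)                    ≡⟨ cong (_· (d ! · monomial c γ)) |γ|≡1+d ⟩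
    suc d · (d ! · monomial c γ)                        ≈⟨ ×-assocˡ _ (suc d) (d !) ⟩
    suc d ! · monomial c γ                              ∎
    where
    p : Series _
    p = linearForm c SerDefs.^ d
    shifted : Fin _ → Carrier
    shifted j = ∑ (below γ) (λ β → X^ (𝐞 j) β * p (Vec.zipWith ℕ._∸_ γ β))
    -- The variable xⱼ contributes the share γⱼ of the total: if γⱼ is positive, then γ! = γⱼ (γ -
    -- eⱼ)! and the induction hypothesis applies to γ - eⱼ; if γⱼ = 0, both sides vanish.
    term : ∀ j a → lookup γ j ≡ a → γ !ᵛ · (lookup c j * shifted j) ≈ lookup γ j · (d ! · monomial c γ)
    term j zero eq = begin
      γ !ᵛ · (lookup c j * shifted j)
        ≈⟨ ×-congʳ (γ !ᵛ) (*-congˡ (∑-zero (below γ) (X^-∉ (λ β → p (Vec.zipWith ℕ._∸_ γ β)) (𝐞∉below γ j eq)))) ⟩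
      γ !ᵛ · (lookup c j * 0#)
        ≈⟨ ×-comm-* (γ !ᵛ) (lookup c j) 0# ⟨
      lookup c j * (γ !ᵛ · 0#)
        -- A multiple of 0 is 0: write 0 as 0 * 0 and pull the multiple into the left factor.
        ≈⟨ *-congˡ (≈-trans (×-congʳ (γ !ᵛ) (≈-sym (zeroˡ 0#))) (≈-trans (≈-sym (×-assoc-* (γ !ᵛ) 0# 0#)) (zeroʳ _))) ⟩
      lookup c j * 0#
        ≈⟨ zeroʳ _ ⟩
      0#
        ≡⟨ cong (_· (d ! · monomial c γ)) eq ⟨
      lookup γ j · (d ! · monomial c γ) ∎
    term j (suc a) eq = begin
      γ !ᵛ · (lookup c j * shifted j)
        ≈⟨ ×-congʳ (γ !ᵛ) (*-congˡ (≈-trans (∑-X^ (λ β → p (Vec.zipWith ℕ._∸_ γ β)) (below-unique γ) (𝐞∈below γ j eq))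
                                            (reflexive (cong p (∸-𝐞 γ j))))) ⟩
      γ !ᵛ · (lookup c j * p γ′)
        ≈⟨ ×-congˡ (decr-! γ j eq) ⟩
      (lookup γ j ℕ.* γ′ !ᵛ) · (lookup c j * p γ′)
        ≈⟨ ×-assocˡ _ (lookup γ j) (γ′ !ᵛ) ⟨
      lookup γ j · (γ′ !ᵛ · (lookup c j * p γ′))
        ≈⟨ ×-congʳ (lookup γ j) (begin
          γ′ !ᵛ · (lookup c j * p γ′)           ≈⟨ ×-comm-* (γ′ !ᵛ) _ _ ⟨
          lookup c j * (γ′ !ᵛ · p γ′)           ≈⟨ *-congˡ (linearForm-^ d c γ′ |γ′|≡d) ⟩
          lookup c j * (d ! · monomial c γ′)    ≈⟨ ×-comm-* (d !) _ _ ⟩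
          d ! · (lookup c j * monomial c γ′)    ≈⟨ ×-congʳ (d !) (monomial-decr c γ j eq) ⟩
          d ! · monomial c γ                    ∎) ⟩
      lookup γ j · (d ! · monomial c γ) ∎
      where
      γ′ = decr γ j
      |γ′|≡d = ℕ.suc-injective (≡.trans (≡.sym (decr-sum γ j eq)) |γ|≡1+d)

  -- Derivatives in the later variables do not move the first exponent, so they act on the slice of
  -- `p` in which it is fixed.
  fold-∂-suc : ∀ {n} (p : Series (suc n)) (q : Series n) b j k → (∀ β → p (b ∷ β) ≡ q β) →
               ∀ β → fold p (∂ (suc j)) k (b ∷ β) ≡ fold q (∂ j) k β
  fold-∂-suc p q b j zero    eq β = eq β
  fold-∂-suc p q b j (suc k) eq β = cong (suc (lookup β j) ·_) (fold-∂-suc p q b j k eq _)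

  foldr-∂-suc : ∀ {n} a (α : Exponent n) (p : Series (suc n)) b (js : List (Fin n)) β →
    List.foldr (λ j q → fold q (∂ j) (lookup (a ∷ α) j)) p (List.map suc js) (b ∷ β) ≡
    List.foldr (λ j q → fold q (∂ j) (lookup α j)) (p ∘ (b ∷_)) js β
  foldr-∂-suc a α p b []       β = refl
  foldr-∂-suc a α p b (j ∷ js) β =
    fold-∂-suc _ _ b j (lookup α j) (foldr-∂-suc a α p b js) β

  -- Each derivative raises the exponent at which `p` is read, so the induction needs an arbitrary
  -- starting exponent b. The accumulated factor (b + k)! / b! is cleared of its denominator.
  fold-∂-zero : ∀ {n} (p : Series (suc n)) k b β →
                b ! · fold p (∂ zero) k (b ∷ β) ≈ (b ℕ.+ k) ! · p (b ℕ.+ k ∷ β)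
  fold-∂-zero p zero    b β = reflexive (≡.sym (cong (λ m → m ! · p (m ∷ β)) (ℕ.+-identityʳ b)))
  fold-∂-zero p (suc k) b β = begin
    b ! · (suc b · fold p (∂ zero) k (suc b ∷ β))   ≈⟨ ×-assocˡ _ (b !) (suc b) ⟩
    (b ! ℕ.* suc b) · fold p (∂ zero) k (suc b ∷ β) ≈⟨ ×-congˡ (ℕ.*-comm (b !) (suc b)) ⟩
    suc b ! · fold p (∂ zero) k (suc b ∷ β)         ≈⟨ fold-∂-zero p k (suc b) β ⟩
    (suc b ℕ.+ k) ! · p (suc b ℕ.+ k ∷ β)           ≡⟨ cong (λ m → m ! · p (m ∷ β)) (ℕ.+-suc b k) ⟨
    (b ℕ.+ suc k) ! · p (b ℕ.+ suc k ∷ β)           ∎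

  -- The derivative in the first variable is outermost in `∂^`. Removing it contributes a! and
  -- leaves the remaining derivatives acting on the slice with first exponent a.
  ∂^-𝟎 : ∀ {n} (α : Exponent n) p → ∂^ α p 𝟎 ≈ α !ᵛ · p α
  ∂^-𝟎 []      p = ≈-sym (×-homo-1 _)
  ∂^-𝟎 (a ∷ α) p = begin
    fold q (∂ zero) a (0 ∷ 𝟎)             ≈⟨ ×-homo-1 _ ⟨
    -- The 1 is 0!, the left factor of `fold-∂-zero` at b = 0.
    1 · fold q (∂ zero) a (0 ∷ 𝟎)         ≈⟨ fold-∂-zero q a 0 𝟎 ⟩
    a ! · q (a ∷ 𝟎)                       ≡⟨ cong (a ! ·_) (≡.trans
      (cong (λ js → List.foldr (λ j q → fold q (∂ j) (lookup (a ∷ α) j)) p js (a ∷ 𝟎))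
        (≡.sym (List.map-tabulate id suc)))
      (foldr-∂-suc a α p a (List.allFin _) 𝟎)) ⟩
    a ! · ∂^ α (p ∘ (a ∷_)) 𝟎             ≈⟨ ×-congʳ (a !) (∂^-𝟎 α (p ∘ (a ∷_))) ⟩
    a ! · (α !ᵛ · p (a ∷ α))              ≈⟨ ×-assocˡ _ (a !) (α !ᵛ) ⟩
    (a ∷ α) !ᵛ · p (a ∷ α)                ∎
    where
    q = List.foldr (λ j q → fold q (∂ j) (lookup (a ∷ α) j)) p (List.tabulate suc)

  -- The apolar pairing: distinct monomials of the same degree are orthogonal, and the monomial with
  -- exponent α pairs with itself to α!.
  ⟨∂⟩-∑ : ∀ {n d} (g f : Form n d) →
          g ⟨∂⟩ f ≈ ∑ (monomials n d) (λ α → coeff g α * (α !ᵛ · coeff f α))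
  ⟨∂⟩-∑ {n} {d} g f = go (monomials n d)
    where
    go : ∀ xs → List.foldr Ser._+_ Ser.0# (List.map (λ α → coeff g α • ∂^ α (coeff f)) xs) 𝟎 ≈
                ∑ xs (λ α → coeff g α * (α !ᵛ · coeff f α))
    go []       = ≈-refl
    go (α ∷ xs) = +-cong (*-congˡ (∂^-𝟎 α (coeff f))) (go xs)

  -- Both sides are linear in the coefficients of f, so they are compared monomial by monomial;
  -- there `linearForm-^` turns d! times the sum of the values ℓᵢ^α into α! g_α.
  apolarity : ∀ {n d r} (g f : Form n d) (ℓ : Fin r → Vec Carrier n) →
              coeff g Ser.≈ SerDefs.sum (λ i → linearForm (ℓ i) SerDefs.^ d) →
              d ! · sum (λ i → eval f (ℓ i)) ≈ g ⟨∂⟩ f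
  apolarity {n} {d} {r} g f ℓ g≈ = begin
    d ! · sum (λ i → eval f (ℓ i))
      ≈⟨ ×-congʳ (d !) (∑-sum-comm {r = r} (monomials n d) _) ⟨
    d ! · ∑ (monomials n d) (λ α → sum λ i → coeff f α * monomial (ℓ i) α)
      ≈⟨ ·-∑ (d !) (monomials n d) _ ⟩
    ∑ (monomials n d) (λ α → d ! · sum λ i → coeff f α * monomial (ℓ i) α)
      ≈⟨ ∑-cong (monomials n d) (λ {α} α∈ → term α (∈-monomials⁻ n d α∈)) ⟩
    ∑ (monomials n d) (λ α → coeff g α * (α !ᵛ · coeff f α))
      ≈⟨ ⟨∂⟩-∑ g f ⟨
    g ⟨∂⟩ f ∎
    where
    ·-∑ : ∀ k (xs : List (Exponent n)) h → k · ∑ xs h ≈ ∑ xs (λ α → k · h α)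
    ·-∑ zero    []       h = ≈-refl
    ·-∑ (suc k) []       h = ≈-trans (+-identityˡ _) (·-∑ k [] h)
    ·-∑ k       (x ∷ xs) h = ≈-trans (×-distrib-+ _ _ k) (+-congˡ (·-∑ k xs h))
    term : ∀ α → Vec.sum α ≡ d → d ! · sum (λ i → coeff f α * monomial (ℓ i) α) ≈ coeff g α * (α !ᵛ · coeff f α)
    term α |α|≡d = begin
      d ! · sum (λ i → coeff f α * monomial (ℓ i) α)
        ≈⟨ ·-sum {r} (d !) _ ⟩
      sum (λ i → d ! · (coeff f α * monomial (ℓ i) α))
        ≈⟨ sum-cong-≋ {r} (λ i → ≈-sym (×-comm-* (d !) _ _)) ⟩
      sum (λ i → coeff f α * (d ! · monomial (ℓ i) α))
        ≈⟨ sum-cong-≋ {r} (λ i → *-congˡ (≈-sym (linearForm-^ d (ℓ i) α |α|≡d))) ⟩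
      sum (λ i → coeff f α * (α !ᵛ · (linearForm (ℓ i) SerDefs.^ d) α))
        ≈⟨ *-distribˡ-sum {r} (coeff f α) (λ i → α !ᵛ · (linearForm (ℓ i) SerDefs.^ d) α) ⟨
      coeff f α * sum (λ i → α !ᵛ · (linearForm (ℓ i) SerDefs.^ d) α)
        ≈⟨ *-congˡ (·-sum {r} (α !ᵛ) _) ⟨
      coeff f α * (α !ᵛ · sum (λ i → (linearForm (ℓ i) SerDefs.^ d) α))
        ≡⟨ cong (λ z → coeff f α * (α !ᵛ · z)) (sum-coeff (λ i → linearForm (ℓ i) SerDefs.^ d) α) ⟨
      coeff f α * (α !ᵛ · SerDefs.sum (λ i → linearForm (ℓ i) SerDefs.^ d) α)
        ≈⟨ *-congˡ (×-congʳ (α !ᵛ) (g≈ α)) ⟨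
      coeff f α * (α !ᵛ · coeff g α)
        ≈⟨ ×-comm-* (α !ᵛ) _ _ ⟩
      α !ᵛ · (coeff f α * coeff g α)
        ≈⟨ ×-congʳ (α !ᵛ) (*-comm _ _) ⟩
      α !ᵛ · (coeff g α * coeff f α)
        ≈⟨ ×-comm-* (α !ᵛ) _ _ ⟨
      coeff g α * (α !ᵛ · coeff f α) ∎

-- Roots of univariate polynomials

module Kronecker (K : CommutativeRing 0ℓ 0ℓ) where
  open CommutativeRing K hiding (zero) renaming (refl to ≈-refl; sym to ≈-sym; trans to ≈-trans)
  open Apolarity K
  open Polynomials rawRing
  open import Algebra.Definitions.RawSemiring (RawRing.rawSemiring rawRing) using (_^_; sum)
    renaming (_×_ to infixr 7 _·_)
  open import Algebra.Properties.CommutativeSemiring.Exp commutativeSemiring using (^-distrib-*)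
  open import Algebra.Properties.CommutativeSemigroup *-commutativeSemigroup using (x∙yz≈y∙xz; interchange)
  open import Algebra.Properties.Semiring.Mult semiring using (×-assoc-*)
  open import Algebra.Properties.Ring (CommutativeRing.ring K) using (x≈y⇒x∙y⁻¹≈ε; [y-z]x≈yx-zx; x∙y⁻¹≈ε⇒x≈y)
  open import Algebra.Solver.Ring.NaturalCoefficients.Default commutativeSemiring
  open import Relation.Binary.Reasoning.Setoid setoid

  horner : List Carrier → Carrier → Carrier
  horner []       x = 0#
  horner (a ∷ as) x = a + x * horner as x

  horner-++ : ∀ as bs x → horner (as ++ bs) x ≈ horner as x + x ^ length as * horner bs x
  horner-++ []       bs x = ≈-sym (≈-trans (+-identityˡ _) (*-identityˡ _))
  horner-++ (a ∷ as) bs x = begin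
    a + x * horner (as ++ bs) x                             ≈⟨ +-congˡ (*-congˡ (horner-++ as bs x)) ⟩
    a + x * (horner as x + x ^ length as * horner bs x)     ≈⟨ solve 5 (λ a x p y q →
      a :+ x :* (p :+ y :* q) := (a :+ x :* p) :+ (x :* y) :* q) ≈-refl a x _ _ _ ⟩
    (a + x * horner as x) + x * x ^ length as * horner bs x ∎

  horner-zeros : ∀ {as} x → All (_≈ 0#) as → horner as x ≈ 0#
  horner-zeros x []       = ≈-refl
  horner-zeros x (a ∷ as) =
    ≈-trans (+-cong a (≈-trans (*-congˡ (horner-zeros x as)) (zeroʳ x))) (+-identityˡ 0#)

  -- quotient as r is the quotient of the polynomial a ∷ as, for any a, by X − r:
  -- synthetic division.
  quotient : List Carrier → Carrier → List Carrier
  quotient []       r = []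
  quotient (a ∷ as) r = horner (a ∷ as) r ∷ quotient as r

  length-quotient : ∀ as r → length (quotient as r) ≡ length as
  length-quotient []       r = refl
  length-quotient (_ ∷ as) r = cong suc (length-quotient as r)

  -- This is p(x) - p(r) = (x - r) q(x), with the negative terms moved across to make it an identity
  -- of semirings.
  quotient-spec : ∀ a as r x → let q = horner (quotient as r) x in
                  horner (a ∷ as) x + r * q ≈ horner (a ∷ as) r + x * q
  quotient-spec a []       r x = solve 3 (λ a x r →
    (a :+ x :* con 0) :+ r :* con 0 := (a :+ r :* con 0) :+ x :* con 0) ≈-refl a x r
  quotient-spec a (b ∷ as) r x = begin
    a + x * px + r * (pr + x * q)   ≈⟨ solve 6 (λ a x px r pr q →
      (a :+ x :* px) :+ r :* (pr :+ x :* q) := (a :+ r :* pr) :+ x :* (px :+ r :* q))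
      ≈-refl a x px r pr q ⟩
    a + r * pr + x * (px + r * q)   ≈⟨ +-congˡ (*-congˡ (quotient-spec b as r x)) ⟩
    a + r * pr + x * (pr + x * q)   ∎
    where
    px = horner (b ∷ as) x
    pr = horner (b ∷ as) r
    q  = horner (quotient as r) x

  head-zero : ∀ {a as} r → horner (a ∷ as) r ≈ 0# → All (_≈ 0#) as → a ≈ 0#
  head-zero {a} {as} r root zeros = begin
    a                   ≈⟨ +-identityʳ a ⟨
    a + 0#              ≈⟨ +-congˡ (zeroʳ r) ⟨
    a + r * 0#          ≈⟨ +-congˡ (*-congˡ (horner-zeros r zeros)) ⟨
    a + r * horner as r ≈⟨ root ⟩
    0#                  ∎

  -- The entries of the quotient are the values at r of the suffixes of `as`. If they all vanish,
  -- the coefficients vanish one after another from the leading one down.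
  quotient-zeros : ∀ as r → All (_≈ 0#) (quotient as r) → All (_≈ 0#) as
  quotient-zeros []       r []       = []
  quotient-zeros (a ∷ as) r (p ∷ ps) = head-zero r p zeros ∷ zeros
    where zeros = quotient-zeros as r ps

  module _ (cancel : ∀ {x y} → ¬ (x ≈ 0#) → x * y ≈ 0# → y ≈ 0#) where

    -- A list of k coefficients has degree below k, so k distinct roots suffice. Dividing by X - r
    -- shortens the list by one, and every other root x stays a root of the quotient because r - x
    -- can be cancelled.
    many-roots⇒zero : ∀ as {rs} → length as ℕ.≤ length rs → AllPairs _≉_ rs →
                      All (λ r → horner as r ≈ 0#) rs → All (_≈ 0#) as
    many-roots⇒zero []       _         _                  _              = []
    many-roots⇒zero (a ∷ as) {r ∷ rs} (s≤s le) (r≉ ∷ distinct) (root ∷ roots) =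
      head-zero r root zeros ∷ zeros
      where
      quotient-root : ∀ {x} → r ≉ x → horner (a ∷ as) x ≈ 0# → horner (quotient as r) x ≈ 0#
      quotient-root {x} r≉x root′ = cancel (r≉x ∘ x∙y⁻¹≈ε⇒x≈y r x) (begin
        (r - x) * q    ≈⟨ [y-z]x≈yx-zx q r x ⟩
        r * q - x * q  ≈⟨ x≈y⇒x∙y⁻¹≈ε (begin
          r * q                       ≈⟨ +-identityˡ _ ⟨
          0# + r * q                  ≈⟨ +-congʳ root′ ⟨
          horner (a ∷ as) x + r * q   ≈⟨ quotient-spec a as r x ⟩
          horner (a ∷ as) r + x * q   ≈⟨ +-congʳ root ⟩
          0# + x * q                  ≈⟨ +-identityˡ _ ⟩
          x * q                       ∎) ⟩
        0#             ∎)
        where q = horner (quotient as r) x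
      zeros = quotient-zeros as r (many-roots⇒zero (quotient as r)
        (ℕ.≤-trans (ℕ.≤-reflexive (length-quotient as r)) le) distinct
        (All.zipWith (λ (r≉x , p) → quotient-root r≉x p) (r≉ , roots)))

  -- Kronecker substitution and rescaled forms

  ∑-++ : ∀ {A : Set} (xs ys : List A) f → ∑ (xs ++ ys) f ≈ ∑ xs f + ∑ ys f
  ∑-++ []       ys f = ≈-sym (+-identityˡ _)
  ∑-++ (x ∷ xs) ys f = ≈-trans (+-congˡ (∑-++ xs ys f)) (≈-sym (+-assoc _ _ _))

  ∑-map : ∀ {A B : Set} (h : A → B) (xs : List A) f → ∑ (List.map h xs) f ≡ ∑ xs (f ∘ h)
  ∑-map h xs f = cong (List.foldr _+_ 0#) (≡.sym (List.map-∘ xs))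

  box : ∀ n → ℕ → List (Exponent n)
  box n d = below (Vec.replicate n d)

  -- Kronecker substitution: each exponent in the box is turned into its position in the
  -- lexicographic enumeration `below`.
  kronecker : ∀ n (d : ℕ) → Carrier → Vec Carrier n
  kronecker zero    d s = []
  kronecker (suc n) d s = s ^ length (box n d) ∷ kronecker n d s

  -- The exponents with a given first entry form a consecutive block of length `length (box n d)`,
  -- and raising the first entry by one multiplies the monomial by s to that length: exactly the
  -- shift by one block.
  ∑-kronecker : ∀ {n} d (C : Series n) s →
    ∑ (box n d) (λ α → C α * monomial (kronecker n d s) α) ≈ horner (List.map C (box n d)) s
  ∑-kronecker {zero}  d C s = +-cong (*-identityʳ _) (≈-sym (zeroʳ s))
  ∑-kronecker {suc n} d C s = ≈-trans (rows (suc d) 0 id λ _ → refl) (*-identityˡ _)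
    where
    y = s ^ length (box n d)
    t = kronecker n d s
    F = λ α → C α * monomial (y ∷ t) α
    -- `upTo` unfolds by shifting its function, so f and the offset k both vary in the induction;
    -- `y ^ k` accounts for the k blocks already passed.
    rows : ∀ m k (f : ℕ → ℕ) → (∀ i → f i ≡ k ℕ.+ i) →
           let L = List.cartesianProductWith _∷_ (List.applyUpTo f m) (box n d) in
           ∑ L F ≈ y ^ k * horner (List.map C L) s
    rows zero    k f eq = ≈-sym (zeroʳ _)
    rows (suc m) k f eq = begin
      ∑ (row ++ rest) F
        ≈⟨ ∑-++ row rest F ⟩
      ∑ row F + ∑ rest F
        ≈⟨ +-cong first (rows m (suc k) (f ∘ suc) λ i → ≡.trans (eq (suc i)) (ℕ.+-suc k i)) ⟩
      y ^ k * horner (List.map C row) s + y * y ^ k * horner (List.map C rest) s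
        ≈⟨ solve 4 (λ a b y c → a :* b :+ (y :* a) :* c := a :* (b :+ y :* c)) ≈-refl
             (y ^ k) (horner (List.map C row) s) y (horner (List.map C rest) s) ⟩
      y ^ k * (horner (List.map C row) s + y * horner (List.map C rest) s)
        ≡⟨ cong (λ l → y ^ k * (horner (List.map C row) s + s ^ l * horner (List.map C rest) s))
                (≡.sym (≡.trans (List.length-map C row) (List.length-map (f 0 ∷_) (box n d)))) ⟩
      y ^ k * (horner (List.map C row) s + s ^ length (List.map C row) * horner (List.map C rest) s)
        ≈⟨ *-congˡ (horner-++ (List.map C row) (List.map C rest) s) ⟨
      y ^ k * horner (List.map C row ++ List.map C rest) s
        ≡⟨ cong (λ as → y ^ k * horner as s) (List.map-++ C row rest) ⟨
      y ^ k * horner (List.map C (row ++ rest)) s ∎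
      where
      row  = List.map (f 0 ∷_) (box n d)
      rest = List.cartesianProductWith _∷_ (List.applyUpTo (f ∘ suc) m) (box n d)
      f0≡k = ≡.trans (eq 0) (ℕ.+-identityʳ k)
      first : ∑ row F ≈ y ^ k * horner (List.map C row) s
      first = begin
        ∑ row F
          ≡⟨ ∑-map (f 0 ∷_) (box n d) F ⟩
        ∑ (box n d) (λ β → C (f 0 ∷ β) * (y ^ f 0 * monomial t β))
          ≈⟨ ∑-cong (box n d) (λ {β} _ → x∙yz≈y∙xz (C (f 0 ∷ β)) (y ^ f 0) (monomial t β)) ⟩
        ∑ (box n d) (λ β → y ^ f 0 * (C (f 0 ∷ β) * monomial t β))
          ≈⟨ *-distribˡ-∑ (box n d) _ _ ⟨
        y ^ f 0 * ∑ (box n d) (λ β → C (f 0 ∷ β) * monomial t β)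
          ≈⟨ *-congˡ (∑-kronecker d (C ∘ (f 0 ∷_)) s) ⟩
        y ^ f 0 * horner (List.map (C ∘ (f 0 ∷_)) (box n d)) s
          ≡⟨ cong₂ (λ e as → y ^ e * horner as s) f0≡k (List.map-∘ (box n d)) ⟩
        y ^ k * horner (List.map C row) s ∎

  monomial-* : ∀ {n} (t v : Vec Carrier n) α →
               monomial (Vec.zipWith _*_ t v) α ≈ monomial t α * monomial v α
  monomial-* []      []      []      = ≈-sym (*-identityˡ 1#)
  monomial-* (x ∷ t) (y ∷ v) (a ∷ α) =
    ≈-trans (*-cong (^-distrib-* x y a) (monomial-* t v α)) (interchange _ _ _ _)

  -- The form f(t₁x₁, ..., tₙxₙ).
  rescale : ∀ {n d} → Vec Carrier n → Form n d → Form n d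
  rescale t f = record
    { coeff       = λ α → coeff f α * monomial t α
    ; homogeneous = λ α |α|≢d → ≈-trans (*-congʳ (homogeneous f α |α|≢d)) (zeroˡ _)
    }

  -- Makes the rescaled form available at the price of one query of f per value.
  eval-rescale : ∀ {n d} (t : Vec Carrier n) (f : Form n d) v →
                 eval (rescale t f) v ≈ eval f (Vec.zipWith _*_ t v)
  eval-rescale {n} {d} t f v = ∑-cong (monomials n d) λ {α} _ →
    ≈-trans (*-assoc _ _ _) (*-congˡ (≈-sym (monomial-* t v α)))

  ⟨∂⟩-rescale : ∀ {n d} (g f : Form n d) s →
    g ⟨∂⟩ rescale (kronecker n d s) f ≈
    horner (List.map (λ α → coeff g α * (α !ᵛ · coeff f α)) (box n d)) s
  ⟨∂⟩-rescale {n} {d} g f s = begin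
    g ⟨∂⟩ rescale t f
      ≈⟨ ⟨∂⟩-∑ g (rescale t f) ⟩
    ∑ (monomials n d) (λ α → coeff g α * (α !ᵛ · (coeff f α * monomial t α)))
      ≈⟨ ∑-cong (monomials n d) (λ {α} _ →
           ≈-trans (*-congˡ (≈-sym (×-assoc-* (α !ᵛ) (coeff f α) (monomial t α)))) (≈-sym (*-assoc _ _ _))) ⟩
    ∑ (monomials n d) (λ α → C α * monomial t α)
      -- Outside degree d the coefficients of g vanish, so the rest of the box may be added.
      ≈⟨ ∑-filter (λ α → Vec.sum α ℕ.≟ d) (box n d) (λ α |α|≢d →
           ≈-trans (*-congʳ (≈-trans (*-congʳ (homogeneous g α |α|≢d)) (zeroˡ _))) (zeroˡ _)) ⟩
    ∑ (box n d) (λ α → C α * monomial t α)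
      ≈⟨ ∑-kronecker d C s ⟩
    horner (List.map C (box n d)) s ∎
    where
    t = kronecker n d s
    C : Series n
    C α = coeff g α * (α !ᵛ · coeff f α)

-- Order, characteristic 0 and the Archimedean property of ℝ

module OrderedField (real : CompleteOrderedField) where
  open CompleteOrderedField real hiding (zero)
    renaming (refl to ≈-refl; sym to ≈-sym; trans to ≈-trans; reflexive to ≈-reflexive)
  open IsTotalOrder isTotalOrder public
    using (antisym; total; isPreorder)
    renaming (refl to ≤-refl; trans to ≤-trans; reflexive to ≤-reflexive)
  open import Algebra.Properties.Ring (CommutativeRing.ring commutativeRing)
    using (-‿distribˡ-*; -‿distribʳ-*; [y-z]x≈yx-zx; -‿involutive)
  open import Algebra.Properties.CommutativeMonoid.Mult +-commutativeMonoid using (×-congʳ)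
  open import Algebra.Properties.Semiring.Mult semiring using (×-assoc-*)

  ≤-preorder : Preorder 0ℓ 0ℓ 0ℓ
  ≤-preorder = record { isPreorder = isPreorder }

  open import Relation.Binary.Reasoning.Preorder ≤-preorder

  ≤-respˡ : ∀ {x y z} → x ≈ y → x ≤ z → y ≤ z
  ≤-respˡ eq = ≤-trans (≤-reflexive (≈-sym eq))

  ≤-respʳ : ∀ {x y z} → y ≈ z → x ≤ y → x ≤ z
  ≤-respʳ eq le = ≤-trans le (≤-reflexive eq)

  +-mono-≤ : ∀ {x y u v} → x ≤ y → u ≤ v → x + u ≤ y + v
  +-mono-≤ {x} {y} {u} {v} x≤y u≤v = begin
    x + u ≲⟨ +-monoˡ-≤ u x≤y ⟩
    y + u ≈⟨ +-comm y u ⟩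
    u + y ≲⟨ +-monoˡ-≤ y u≤v ⟩
    v + y ≈⟨ +-comm v y ⟩
    y + v ∎

  +-nonNeg : ∀ {x y} → 0# ≤ x → 0# ≤ y → 0# ≤ x + y
  +-nonNeg 0≤x 0≤y = ≤-respˡ (+-identityˡ 0#) (+-mono-≤ 0≤x 0≤y)

  +-cancelʳ-≤ : ∀ {x y} z → x + z ≤ y + z → x ≤ y
  +-cancelʳ-≤ {x} {y} z le = ≤-respˡ (undo x) (≤-respʳ (undo y) (+-monoˡ-≤ (- z) le))
    where
    undo : ∀ w → w + z - z ≈ w
    undo w = ≈-trans (+-assoc w z (- z)) (≈-trans (+-congˡ (-‿inverseʳ z)) (+-identityʳ w))

  x≤0⇒0≤-x : ∀ {x} → x ≤ 0# → 0# ≤ - x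
  x≤0⇒0≤-x {x} x≤0 = ≤-respˡ (-‿inverseʳ x) (≤-respʳ (+-identityˡ (- x)) (+-monoˡ-≤ (- x) x≤0))

  0≤x² : ∀ x → 0# ≤ x * x
  0≤x² x with total 0# x
  ... | inj₁ 0≤x = *-nonNeg 0≤x 0≤x
  ... | inj₂ x≤0 = ≤-respʳ (≈-trans (≈-sym (-‿distribˡ-* x (- x)))
      (≈-trans (-‿cong (≈-sym (-‿distribʳ-* x x))) (-‿involutive (x * x))))
    (*-nonNeg (x≤0⇒0≤-x x≤0) (x≤0⇒0≤-x x≤0))

  0≤1 : 0# ≤ 1#
  0≤1 = ≤-respʳ (*-identityˡ 1#) (0≤x² 1#)

  -- The absence of cancellation, used for sums of nonnegative terms, for the norm a² + b², and for
  -- characteristic 0.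
  x+y≈0⇒x≈0 : ∀ {x y} → 0# ≤ x → 0# ≤ y → x + y ≈ 0# → x ≈ 0#
  x+y≈0⇒x≈0 {x} {y} 0≤x 0≤y eq = antisym (begin
    x      ≈⟨ +-identityˡ x ⟨
    0# + x ≲⟨ +-monoˡ-≤ x 0≤y ⟩
    y + x  ≈⟨ +-comm y x ⟩
    x + y  ≈⟨ eq ⟩
    0#     ∎) 0≤x

  x+y≈0⇒y≈0 : ∀ {x y} → 0# ≤ x → 0# ≤ y → x + y ≈ 0# → y ≈ 0#
  x+y≈0⇒y≈0 0≤x 0≤y eq = x+y≈0⇒x≈0 0≤y 0≤x (≈-trans (+-comm _ _) eq)

  *-cancel-≉0 : ∀ {x y} → ¬ (x ≈ 0#) → x * y ≈ 0# → y ≈ 0#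
  *-cancel-≉0 {x} {y} x≉0 eq with inverse x x≉0
  ... | x⁻¹ , xx⁻¹≈1 = begin-equality
    y               ≈⟨ *-identityˡ y ⟨
    1# * y          ≈⟨ *-congʳ (≈-trans (≈-sym xx⁻¹≈1) (*-comm x x⁻¹)) ⟩
    x⁻¹ * x * y     ≈⟨ *-assoc x⁻¹ x y ⟩
    x⁻¹ * (x * y)   ≈⟨ *-congˡ eq ⟩
    x⁻¹ * 0#        ≈⟨ zeroʳ x⁻¹ ⟩
    0#              ∎

  *-monoʳ-≤ : ∀ {x y z} → 0# ≤ z → x ≤ y → x * z ≤ y * z
  *-monoʳ-≤ {x} {y} {z} 0≤z x≤y = +-cancelʳ-≤ (- (x * z)) (begin
    x * z - x * z ≈⟨ -‿inverseʳ (x * z) ⟩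
    0#            ≲⟨ *-nonNeg (≤-respˡ (-‿inverseʳ x) (+-monoˡ-≤ (- x) x≤y)) 0≤z ⟩
    (y - x) * z   ≈⟨ [y-z]x≈yx-zx z y x ⟩
    y * z - x * z ∎)

  fromℕ-nonNeg : ∀ m → 0# ≤ fromℕ m
  fromℕ-nonNeg zero    = ≤-refl
  fromℕ-nonNeg (suc m) = +-nonNeg 0≤1 (fromℕ-nonNeg m)

  -- Were 1 + m equal to 0 with both summands nonnegative, 1 would be 0.
  fromℕ-≉0 : ∀ m → ¬ (fromℕ (suc m) ≈ 0#)
  fromℕ-≉0 m eq = 0≉1 (≈-sym (x+y≈0⇒x≈0 0≤1 (fromℕ-nonNeg m) eq))

  fromℕ-mono : ∀ {k m} → k ℕ.≤ m → fromℕ k ≤ fromℕ m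
  fromℕ-mono {m = m} z≤n = fromℕ-nonNeg m
  fromℕ-mono (s≤s le) = +-mono-≤ ≤-refl (fromℕ-mono le)

  fromℕ-injective : ∀ {k m} → fromℕ k ≈ fromℕ m → k ≡ m
  fromℕ-injective {zero}  {zero}  eq = refl
  fromℕ-injective {zero}  {suc m} eq = contradiction (≈-sym eq) (fromℕ-≉0 m)
  fromℕ-injective {suc k} {zero}  eq = contradiction eq (fromℕ-≉0 k)
  fromℕ-injective {suc k} {suc m} eq = cong suc (fromℕ-injective (∙-cancelˡ 1# _ _ eq))
    where open import Algebra.Properties.Group +-group using (∙-cancelˡ)

  ·-nonNeg : ∀ k {x} → 0# ≤ x → 0# ≤ k · x
  ·-nonNeg zero    0≤x = ≤-refl
  ·-nonNeg (suc k) 0≤x = +-nonNeg 0≤x (·-nonNeg k 0≤x)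

  ·-cancel : ∀ k .{{_ : ℕ.NonZero k}} {x} → k · x ≈ 0# → x ≈ 0#
  ·-cancel (suc k) {x} eq = *-cancel-≉0 (fromℕ-≉0 k)
    (≈-trans (×-assoc-* (suc k) 1# x) (≈-trans (×-congʳ (suc k) (*-identityˡ x)) eq))

  module _ (em : ExcludedMiddle 0ℓ) where

    -- Otherwise the multiples of δ have a supremum s, and s − δ is a smaller upper bound.
    archimedean : ∀ {δ} → 0# < δ → ∀ b → ∃ λ m → b ≤ fromℕ m * δ
    archimedean {δ} (0≤δ , 0≉δ) b with em {∃ λ m → b ≤ fromℕ m * δ}
    ... | yes p = p
    ... | no ¬p = contradiction (antisym 0≤δ δ≤0) 0≉δ
      where
      Multiple : Pred Carrier 0ℓ
      Multiple x = ∃ λ m → x ≈ fromℕ m * δ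
      bounded : ∀ x → Multiple x → x ≤ b
      bounded x (m , eq) with total b (fromℕ m * δ)
      ... | inj₁ b≤ = contradiction (m , b≤) ¬p
      ... | inj₂ ≤b = ≤-respˡ (≈-sym eq) ≤b
      sup = supremum Multiple (0# , 0 , ≈-sym (zeroˡ δ)) (b , bounded)
      s = proj₁ sup
      s-δ-bound : ∀ x → Multiple x → x ≤ s - δ
      s-δ-bound x (m , eq) = +-cancelʳ-≤ δ (begin
        x + δ                  ≈⟨ +-comm x δ ⟩
        δ + x                  ≈⟨ +-cong (≈-sym (*-identityˡ δ)) eq ⟩
        1# * δ + fromℕ m * δ   ≈⟨ distribʳ δ 1# (fromℕ m) ⟨
        fromℕ (suc m) * δ      ≲⟨ proj₁ (proj₂ sup) _ (suc m , ≈-refl) ⟩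
        s                      ≈⟨ +-identityʳ s ⟨
        s + 0#                 ≈⟨ +-congˡ (-‿inverseˡ δ) ⟨
        s + (- δ + δ)          ≈⟨ +-assoc s (- δ) δ ⟨
        s - δ + δ              ∎)
      δ≤0 : δ ≤ 0#
      δ≤0 = +-cancelʳ-≤ (s - δ) (begin
        δ + (s - δ)      ≈⟨ +-comm δ _ ⟩
        s - δ + δ        ≈⟨ +-assoc s (- δ) δ ⟩
        s + (- δ + δ)    ≈⟨ +-congˡ (-‿inverseˡ δ) ⟩
        s + 0#           ≈⟨ +-identityʳ s ⟩
        s                ≲⟨ proj₂ (proj₂ sup) (s - δ) s-δ-bound ⟩
        s - δ            ≈⟨ +-identityˡ _ ⟨
        0# + (s - δ)     ∎)

-- ℂ as an integral domain of characteristic 0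

factorial-nonZero : ∀ {n} (α : Exponent n) → ℕ.NonZero (α !ᵛ)
factorial-nonZero []      = _
factorial-nonZero (a ∷ α) = ℕ.m*n≢0 (a !) (α !ᵛ) {{a ℕ.!≢0}} {{factorial-nonZero α}}

module Complex (em : ExcludedMiddle 0ℓ) (real : CompleteOrderedField) where
  open Theory em real
  open OrderedField real
  open RawRing ℂ-rawRing
  open import Algebra.Definitions.RawSemiring (RawRing.rawSemiring ℂ-rawRing) using (sum)
    renaming (_×_ to infixr 7 _·_)

  ℂ-isCommutativeRing : IsCommutativeRing _≈_ _+_ _*_ -_ 0# 1#
  ℂ-isCommutativeRing = record
    { isRing = record
      { +-isAbelianGroup = record
        { isGroup = record
          { isMonoid = record
            { isSemigroup = record
              { isMagma = record
                { isEquivalence = record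
                  { refl  = ℝ.refl , ℝ.refl
                  ; sym   = λ (p , q) → ℝ.sym p , ℝ.sym q
                  ; trans = λ (p , q) (p′ , q′) → ℝ.trans p p′ , ℝ.trans q q′
                  }
                ; ∙-cong = λ (p , q) (p′ , q′) → ℝ.+-cong p p′ , ℝ.+-cong q q′
                }
              ; assoc = λ x y z → ℝ.+-assoc _ _ _ , ℝ.+-assoc _ _ _
              }
            ; identity = (λ x → ℝ.+-identityˡ _ , ℝ.+-identityˡ _) ,
                         (λ x → ℝ.+-identityʳ _ , ℝ.+-identityʳ _)
            }
          ; inverse = (λ x → ℝ.-‿inverseˡ _ , ℝ.-‿inverseˡ _) ,
                      (λ x → ℝ.-‿inverseʳ _ , ℝ.-‿inverseʳ _)
          ; ⁻¹-cong = λ (p , q) → ℝ.-‿cong p , ℝ.-‿cong q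
          }
        ; comm = λ x y → ℝ.+-comm _ _ , ℝ.+-comm _ _
        }
      ; *-cong = λ (p , q) (p′ , q′) →
          ℝ.+-cong (ℝ.*-cong p p′) (ℝ.-‿cong (ℝ.*-cong q q′)) ,
          ℝ.+-cong (ℝ.*-cong p q′) (ℝ.*-cong q p′)
      ; *-assoc = *-assoc
      ; *-identity = (λ z → ≈-trans (*-comm 1# z) (*-identityʳ z)) , *-identityʳ
      ; distrib = distribˡ ,
          λ x y z → ≈-trans (*-comm (y + z) x) (≈-trans (distribˡ x y z)
            (ℝ.+-cong (proj₁ (*-comm x y)) (proj₁ (*-comm x z)) ,
             ℝ.+-cong (proj₂ (*-comm x y)) (proj₂ (*-comm x z))))
      }
    ; *-comm = *-comm
    }
    where
    open import Algebra.Solver.Ring.NaturalCoefficients.Default ℝ.commutativeSemiring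
    open import Algebra.Properties.Ring (CommutativeRing.ring ℝ.commutativeRing) using (-1*x≈-x; -0#≈0#)
    ≈-trans : ∀ {x y z} → x ≈ y → y ≈ z → x ≈ z
    ≈-trans (p , q) (p′ , q′) = ℝ.trans p p′ , ℝ.trans q q′
    m : ℝ
    m = ℝ.- ℝ.1#
    -- Writing −x as m x turns the ring axioms for ℂ into semiring identities over ℝ.
    neg : ∀ {x} → ℝ.- x ℝ.≈ m ℝ.* x
    neg {x} = ℝ.sym (-1*x≈-x x)

    *-comm : ∀ x y → x * y ≈ y * x
    *-comm (a +i b) (c +i d) =
      ℝ.+-cong (ℝ.*-comm a c) (ℝ.-‿cong (ℝ.*-comm b d)) ,
      solve 4 (λ a b c d → a :* d :+ b :* c := c :* b :+ d :* a) ℝ.refl a b c d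

    *-assoc : ∀ x y z → (x * y) * z ≈ x * (y * z)
    *-assoc (a +i b) (c +i d) (e +i f) =
      ℝ.trans (ℝ.+-cong (ℝ.*-congʳ (ℝ.+-congˡ neg)) neg)
        (ℝ.trans (solve 7 (λ a b c d e f m →
          (a :* c :+ m :* (b :* d)) :* e :+ m :* ((a :* d :+ b :* c) :* f) :=
          a :* (c :* e :+ m :* (d :* f)) :+ m :* (b :* (c :* f :+ d :* e))) ℝ.refl a b c d e f m)
        (ℝ.sym (ℝ.+-cong (ℝ.*-congˡ (ℝ.+-congˡ neg)) neg))) ,
      ℝ.trans (ℝ.+-congʳ (ℝ.*-congʳ (ℝ.+-congˡ neg)))
        (ℝ.trans (solve 7 (λ a b c d e f m →
          (a :* c :+ m :* (b :* d)) :* f :+ (a :* d :+ b :* c) :* e :=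
          a :* (c :* f :+ d :* e) :+ b :* (c :* e :+ m :* (d :* f))) ℝ.refl a b c d e f m)
        (ℝ.sym (ℝ.+-congˡ (ℝ.*-congˡ (ℝ.+-congˡ neg)))))

    *-identityʳ : ∀ z → z * 1# ≈ z
    *-identityʳ (a +i b) =
      ℝ.trans (ℝ.+-cong (ℝ.*-identityʳ a) (ℝ.trans (ℝ.-‿cong (ℝ.zeroʳ b)) -0#≈0#)) (ℝ.+-identityʳ a) ,
      ℝ.trans (ℝ.+-cong (ℝ.zeroʳ a) (ℝ.*-identityʳ b)) (ℝ.+-identityˡ b)

    distribˡ : ∀ x y z → x * (y + z) ≈ x * y + x * z
    distribˡ (a +i b) (c +i d) (e +i f) =
      ℝ.trans (ℝ.+-congˡ neg) (ℝ.trans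
        (solve 7 (λ a b c d e f m →
          a :* (c :+ e) :+ m :* (b :* (d :+ f)) :=
          (a :* c :+ m :* (b :* d)) :+ (a :* e :+ m :* (b :* f))) ℝ.refl a b c d e f m)
        (ℝ.sym (ℝ.+-cong (ℝ.+-congˡ neg) (ℝ.+-congˡ neg)))) ,
      solve 6 (λ a b c d e f →
        a :* (d :+ f) :+ b :* (c :+ e) := (a :* d :+ b :* c) :+ (a :* f :+ b :* e)) ℝ.refl a b c d e f

  ℂ-ring : CommutativeRing 0ℓ 0ℓ
  ℂ-ring = record { isCommutativeRing = ℂ-isCommutativeRing }

  -- If z = a + b i and z w = 0, then (a² + b²) w = 0.
  ℂ-*-cancel-≉0 : ∀ {z w} → ¬ (z ≈ 0#) → z * w ≈ 0# → w ≈ 0#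
  ℂ-*-cancel-≉0 {a +i b} {c +i d} z≉0 (ac-bd≈0 , ad+bc≈0) =
    *-cancel-≉0 norm≉0 norm*c≈0 , *-cancel-≉0 norm≉0 norm*d≈0
    where
    open import Algebra.Solver.Ring.NaturalCoefficients.Default ℝ.commutativeSemiring
    open import Algebra.Properties.Ring (CommutativeRing.ring ℝ.commutativeRing) using (x∙y⁻¹≈ε⇒x≈y)
    open import Relation.Binary.Reasoning.Setoid ℝ.setoid
    norm = a ℝ.* a ℝ.+ b ℝ.* b
    ac≈bd = x∙y⁻¹≈ε⇒x≈y (a ℝ.* c) (b ℝ.* d) ac-bd≈0
    square-zero : ∀ {x} → x ℝ.* x ℝ.≈ ℝ.0# → x ℝ.≈ ℝ.0#
    square-zero {x} x²≈0 with em {x ℝ.≈ ℝ.0#}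
    ... | yes x≈0 = x≈0
    ... | no x≉0  = *-cancel-≉0 x≉0 x²≈0
    norm≉0 : ¬ (norm ℝ.≈ ℝ.0#)
    norm≉0 eq = z≉0 (square-zero (x+y≈0⇒x≈0 (0≤x² a) (0≤x² b) eq) ,
                     square-zero (x+y≈0⇒y≈0 (0≤x² a) (0≤x² b) eq))
    norm*c≈0 : norm ℝ.* c ℝ.≈ ℝ.0#
    norm*c≈0 = begin
      norm ℝ.* c                                      ≈⟨ solve 3 (λ a b c →
        (a :* a :+ b :* b) :* c := a :* (a :* c) :+ b :* (b :* c)) ℝ.refl a b c ⟩
      a ℝ.* (a ℝ.* c) ℝ.+ b ℝ.* (b ℝ.* c)             ≈⟨ ℝ.+-congʳ (ℝ.*-congˡ ac≈bd) ⟩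
      a ℝ.* (b ℝ.* d) ℝ.+ b ℝ.* (b ℝ.* c)             ≈⟨ solve 4 (λ a b c d →
        a :* (b :* d) :+ b :* (b :* c) := b :* (a :* d :+ b :* c)) ℝ.refl a b c d ⟩
      b ℝ.* (a ℝ.* d ℝ.+ b ℝ.* c)                     ≈⟨ ℝ.*-congˡ ad+bc≈0 ⟩
      b ℝ.* ℝ.0#                                      ≈⟨ ℝ.zeroʳ b ⟩
      ℝ.0#                                            ∎
    norm*d≈0 : norm ℝ.* d ℝ.≈ ℝ.0#
    norm*d≈0 = begin
      norm ℝ.* d                                      ≈⟨ solve 3 (λ a b d →
        (a :* a :+ b :* b) :* d := a :* (a :* d) :+ b :* (b :* d)) ℝ.refl a b d ⟩
      a ℝ.* (a ℝ.* d) ℝ.+ b ℝ.* (b ℝ.* d)             ≈⟨ ℝ.+-congˡ (ℝ.*-congˡ ac≈bd) ⟨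
      a ℝ.* (a ℝ.* d) ℝ.+ b ℝ.* (a ℝ.* c)             ≈⟨ solve 4 (λ a b c d →
        a :* (a :* d) :+ b :* (a :* c) := a :* (a :* d :+ b :* c)) ℝ.refl a b c d ⟩
      a ℝ.* (a ℝ.* d ℝ.+ b ℝ.* c)                     ≈⟨ ℝ.*-congˡ ad+bc≈0 ⟩
      a ℝ.* ℝ.0#                                      ≈⟨ ℝ.zeroʳ a ⟩
      ℝ.0#                                            ∎

  open CommutativeRing ℂ-ring
    using (*-congˡ; *-congʳ; zeroʳ; zeroˡ; +-cong; +-identityˡ)
    renaming (refl to ≈-refl; sym to ≈-sym; trans to ≈-trans)
  open Apolarity ℂ-ring using (apolarity)

  re-· : ∀ k z → re (k · z) ≡ k ℝ.· re z
  re-· zero    z = refl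
  re-· (suc k) z = cong (re z ℝ.+_) (re-· k z)

  im-· : ∀ k z → im (k · z) ≡ k ℝ.· im z
  im-· zero    z = refl
  im-· (suc k) z = cong (im z ℝ.+_) (im-· k z)

  ℂ-·-cancel : ∀ k .{{_ : ℕ.NonZero k}} {z} → k · z ≈ 0# → z ≈ 0#
  ℂ-·-cancel k {z} (p , q) =
    ·-cancel k (≡.subst (ℝ._≈ ℝ.0#) (re-· k z) p) , ·-cancel k (≡.subst (ℝ._≈ ℝ.0#) (im-· k z) q)

  ·-zero : ∀ k {z} → z ≈ 0# → k · z ≈ 0#
  ·-zero zero    eq = ≈-refl
  ·-zero (suc k) eq = ≈-trans (+-cong eq (·-zero k eq)) (+-identityˡ 0#)

  term : ∀ {n d} (g f : Form n d) → Exponent n → ℂ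
  term g f α = coeff g α * (α !ᵛ · coeff f α)

  term-zero : ∀ {n d} (g f : Form n d) → Empty (supp f ∩ supp g) → ∀ α → term g f α ≈ 0#
  term-zero g f empty α with em {coeff f α ≈ 0#} | em {coeff g α ≈ 0#}
  ... | yes f≈0 | _       = ≈-trans (*-congˡ (·-zero (α !ᵛ) f≈0)) (zeroʳ _)
  ... | no _    | yes g≈0 = ≈-trans (*-congʳ g≈0) (zeroˡ _)
  ... | no f≉0  | no g≉0  = contradiction (f≉0 , g≉0) (empty α)

  term-nonzero : ∀ {n d} (g f : Form n d) {α} → α ∈ supp f ∩ supp g → ¬ (term g f α ≈ 0#)
  term-nonzero g f {α} (f≉0 , g≉0) eq =
    f≉0 (ℂ-·-cancel (α !ᵛ) {{factorial-nonZero α}} (ℂ-*-cancel-≉0 g≉0 eq))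

  supp⇒degree : ∀ {n d} (f : Form n d) {α} → α ∈ supp f → Vec.sum α ≡ d
  supp⇒degree {d = d} f {α} α∈ with Vec.sum α ℕ.≟ d
  ... | yes eq = eq
  ... | no ≢d  = contradiction (homogeneous f α ≢d) α∈

  -- Since d! can be cancelled, a zero test may be applied to the plain sum of the answers.
  waring-sum-zero⇔ : ∀ {n d r} (g f : Form n d) (ℓ : Fin r → Vec ℂ n) →
    coeff g Ser.≈ SerDefs.sum (λ i → linearForm (ℓ i) SerDefs.^ d) →
    sum (λ i → eval f (ℓ i)) ≈ 0# ⇔ g ⟨∂⟩ f ≈ 0#
  waring-sum-zero⇔ {d = d} g f ℓ g≈ = mk⇔
    (λ eq → ≈-trans (≈-sym (apolarity g f ℓ g≈)) (·-zero (d !) eq))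
    (λ eq → ℂ-·-cancel (d !) {{d ℕ.!≢0}} (≈-trans (apolarity g f ℓ g≈) eq))

-- Algorithms that query fixed points and add the answers

length-filter-split : ∀ {A : Set} {P : Pred A 0ℓ} (P? : Decidable P) xs →
  length (List.filter P? xs) ℕ.+ length (List.filter (λ x → ¬? (P? x)) xs) ≡ length xs
length-filter-split P? []       = refl
length-filter-split P? (x ∷ xs) with P? x
... | yes _ = cong suc (length-filter-split P? xs)
... | no  _ = ≡.trans (ℕ.+-suc _ _) (cong suc (length-filter-split P? xs))

module Algorithms (em : ExcludedMiddle 0ℓ) (real : CompleteOrderedField) where
  open Theory em real
  open OrderedField real hiding (total)
  open Complex em real
  open CommutativeRing ℂ-ring hiding (zero) renaming (refl to ≈-refl; sym to ≈-sym; trans to ≈-trans)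
  open import Algebra.Definitions.RawSemiring (RawRing.rawSemiring ℂ-rawRing) using (sum)
    renaming (_×_ to infixr 7 _·_)
  open import Algebra.Properties.CommutativeMonoid.Mult +-commutativeMonoid using (×-congʳ)
  open import Algebra.Properties.Semiring.Mult semiring using (×-assoc-*)
  open import Algebra.Properties.Semiring.Sum semiring using (sum-cong-≋)
  open Apolarity ℂ-ring using (apolarity; ⟨∂⟩-∑; ∑-zero)
  open Kronecker ℂ-ring

  -- The continuation works for any number of received answers, which avoids transporting trees
  -- along equations between sums of naturals.
  ask : ∀ {n Out k} q → (Fin q → Vec ℂ n) → (∀ {m} → Tree n Out m 0) → Tree n Out k q
  ask zero    v t = t
  ask (suc q) v t = query (Vec.map con (v zero)) (ask q (v ∘ suc) t)

  -- Indexing through a map h lets the recursion run over m while the number k of variables stays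
  -- fixed.
  sumVars : ∀ {k m} → (Fin m → Fin k) → Expr k
  sumVars {m = zero}  h = con 0#
  sumVars {m = suc m} h = var (h zero) ⊕ sumVars (h ∘ suc)

  ⟦sumVars⟧-suc : ∀ {k m} (h : Fin m → Fin k) x ρ → ⟦ sumVars (suc ∘ h) ⟧ (x ∷ ρ) ≡ ⟦ sumVars h ⟧ ρ
  ⟦sumVars⟧-suc {m = zero}  h x ρ = refl
  ⟦sumVars⟧-suc {m = suc m} h x ρ = cong (lookup ρ (h zero) +_) (⟦sumVars⟧-suc (h ∘ suc) x ρ)

  answerSum : ∀ {k} → Expr k
  answerSum = sumVars id

  -- The final list of answers is left abstract; all that is recorded of it is its sum, which
  -- includes the answers present at the start.
  run-ask : ∀ {n Out k} {A : Set} (out : ∀ {m} → Out m → Vec ℂ m → A) (oracle : Vec ℂ n → ℂ)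
            q (v : Fin q → Vec ℂ n) (t : ∀ {m} → Tree n Out m 0) (ρ : Vec ℂ k) →
            ∃ λ m → ∃ λ (ρ′ : Vec ℂ m) →
              run out oracle (ask q v t) ρ ≡ run out oracle t ρ′ ×
              ⟦ answerSum ⟧ ρ′ ≈ sum (λ i → oracle (v i)) + ⟦ answerSum ⟧ ρ
  run-ask out oracle zero    v t ρ = _ , ρ , refl , ≈-sym (+-identityˡ _)
  run-ask out oracle (suc q) v t ρ
    with run-ask out oracle q (v ∘ suc) t
           (oracle (Vec.map (λ e → ⟦ e ⟧ ρ) (Vec.map con (v zero))) ∷ ρ)
  ... | m , ρ′ , run≡ , total≈ = m , ρ′ , run≡ , (begin
    ⟦ answerSum ⟧ ρ′
      ≈⟨ total≈ ⟩
    rest + (oracle (Vec.map (λ e → ⟦ e ⟧ ρ) (Vec.map con (v zero))) + ⟦ sumVars suc ⟧ (_ ∷ ρ))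
      ≡⟨ cong₂ (λ p x → rest + (oracle p + x)) constants (⟦sumVars⟧-suc id _ ρ) ⟩
    rest + (oracle (v zero) + ⟦ answerSum ⟧ ρ)
      ≈⟨ +-assoc _ _ _ ⟨
    rest + oracle (v zero) + ⟦ answerSum ⟧ ρ
      ≈⟨ +-congʳ (+-comm _ _) ⟩
    oracle (v zero) + rest + ⟦ answerSum ⟧ ρ ∎)
    where
    open import Relation.Binary.Reasoning.Setoid setoid
    rest = sum (λ i → oracle (v (suc i)))
    constants : Vec.map (λ e → ⟦ e ⟧ ρ) (Vec.map con (v zero)) ≡ v zero
    constants = ≡.trans (≡.sym (Vec.map-∘ _ con (v zero))) (Vec.map-id (v zero))

  zeroTest : ∀ {n} q → (Fin q → Vec ℂ n) → DecisionAlgorithm n q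
  zeroTest q v = ask q v (ifZero answerSum (return disjoint) (return intersecting))

  decide-zeroTest : ∀ {n d q} (v : Fin q → Vec ℂ n) (f : Form n d) →
                    decide (zeroTest q v) f ≡ disjoint ⇔ sum (λ i → eval f (v i)) ≈ 0#
  decide-zeroTest {q = q} v f
    with run-ask (λ o _ → o) (eval f) q v (ifZero answerSum (return disjoint) (return intersecting)) []
  -- This is the very test that `run` performs at `ifZero`, so each branch reduces `run≡` to a
  -- definite verdict.
  ... | m , ρ′ , run≡ , total≈ with em {⟦ answerSum ⟧ ρ′ ≈ 0#}
  ... | yes eq = mk⇔ (λ _ → ≈-trans (≈-sym (≈-trans total≈ (+-identityʳ _))) eq) (λ _ → run≡)
  ... | no ≉0  = mk⇔
    (λ eq → contradiction (≡.trans (≡.sym run≡) eq) λ ())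
    (λ eq → contradiction (≈-trans total≈ (≈-trans (+-identityʳ _) eq)) ≉0)

  -- Nonnegative sums, approximation and the deterministic algorithms

  nonNeg-zero : IsNonNegative 0#
  nonNeg-zero = ℝ.refl , ≤-refl

  +-isReal : ∀ {z w} → IsReal z → IsReal w → IsReal (z + w)
  +-isReal z w = ℝ.trans (ℝ.+-cong z w) (ℝ.+-identityˡ _)

  *-isReal : ∀ {z w} → IsReal z → IsReal w → IsReal (z * w)
  *-isReal z w = ℝ.trans (ℝ.+-cong (ℝ.trans (ℝ.*-congˡ w) (ℝ.zeroʳ _)) (ℝ.trans (ℝ.*-congʳ z) (ℝ.zeroˡ _)))
                         (ℝ.+-identityˡ _)

  re-* : ∀ {z w} → IsReal w → re (z * w) ℝ.≈ re z ℝ.* re w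
  re-* w = ℝ.trans (ℝ.+-congˡ (ℝ.trans (ℝ.-‿cong (ℝ.trans (ℝ.*-congˡ w) (ℝ.zeroʳ _))) -0#≈0#)) (ℝ.+-identityʳ _)
    where open import Algebra.Properties.Ring (CommutativeRing.ring ℝ.commutativeRing) using (-0#≈0#)

  nonNeg-+ : ∀ {z w} → IsNonNegative z → IsNonNegative w → IsNonNegative (z + w)
  nonNeg-+ {z} {w} (z-real , 0≤z) (w-real , 0≤w) = +-isReal {z} {w} z-real w-real , +-nonNeg 0≤z 0≤w

  nonNeg-* : ∀ {z w} → IsNonNegative z → IsNonNegative w → IsNonNegative (z * w)
  nonNeg-* {z} {w} (z-real , 0≤z) (w-real , 0≤w) =
    *-isReal {z} {w} z-real w-real , ≤-respʳ (ℝ.sym (re-* {z} w-real)) (ℝ.*-nonNeg 0≤z 0≤w)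

  nonNeg-· : ∀ k {z} → IsNonNegative z → IsNonNegative (k · z)
  nonNeg-· zero    z = nonNeg-zero
  nonNeg-· (suc k) z = nonNeg-+ z (nonNeg-· k z)

  nonNeg-∑ : ∀ {A : Set} (xs : List A) {h : A → ℂ} → (∀ x → IsNonNegative (h x)) → IsNonNegative (∑ xs h)
  nonNeg-∑ []       p = nonNeg-zero
  nonNeg-∑ (x ∷ xs) p = nonNeg-+ (p x) (nonNeg-∑ xs p)

  -- The head and the sum of the tail are both nonnegative reals, so neither can offset the other.
  ∑-zero⁻ : ∀ {A : Set} (xs : List A) {h : A → ℂ} → (∀ x → IsNonNegative (h x)) → ∑ xs h ≈ 0# →
            ∀ {x} → x ∈ˡ xs → h x ≈ 0#
  ∑-zero⁻ (x ∷ xs) p (eq , _) (here refl) =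
    x+y≈0⇒x≈0 (proj₂ (p x)) (proj₂ (nonNeg-∑ xs p)) eq , proj₁ (p x)
  ∑-zero⁻ (x ∷ xs) p (eq , _) (there x∈)  =
    ∑-zero⁻ xs p (x+y≈0⇒y≈0 (proj₂ (p x)) (proj₂ (nonNeg-∑ xs p)) eq , proj₁ (nonNeg-∑ xs p)) x∈

  term-nonNeg : ∀ {n d} (g f : Form n d) → NonNegativeForm g → NonNegativeForm f →
                ∀ α → IsNonNegative (term g f α)
  term-nonNeg g f g≥0 f≥0 α = nonNeg-* (g≥0 α) (nonNeg-· (α !ᵛ) (f≥0 α))

  ⟨∂⟩-zero⇔ : ∀ {n d} (g f : Form n d) → NonNegativeForm g → NonNegativeForm f →
              g ⟨∂⟩ f ≈ 0# ⇔ Empty (supp f ∩ supp g)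
  ⟨∂⟩-zero⇔ {n} {d} g f g≥0 f≥0 = mk⇔
    (λ eq α α∈ → term-nonzero g f α∈
      (∑-zero⁻ (monomials n d) (term-nonNeg g f g≥0 f≥0) (≈-trans (≈-sym (⟨∂⟩-∑ g f)) eq)
        (∈-monomials⁺ (supp⇒degree f (proj₁ α∈)))))
    (λ empty → ≈-trans (⟨∂⟩-∑ g f) (∑-zero (monomials n d) λ {α} _ → term-zero g f empty α))

  approximates-resp : ∀ {ε M N z w} → M ≈ N → z ≈ w → Approximates ε M z → Approximates ε N w
  approximates-resp (M≈N , _) (z≈w , im≈) (z , lo , hi) =
    ℝ.trans (ℝ.sym im≈) z ,
    ≤-respˡ (ℝ.*-congˡ M≈N) (≤-respʳ z≈w lo) ,
    ≤-respˡ z≈w (≤-respʳ (ℝ.*-congˡ M≈N) hi)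

  approximates-+ : ∀ {ε M N z w} → Approximates ε M z → Approximates ε N w → Approximates ε (M + N) (z + w)
  approximates-+ {z = z} {w} (z-real , lo , hi) (w-real , lo′ , hi′) =
    +-isReal {z} {w} z-real w-real ,
    ≤-respˡ (ℝ.sym (ℝ.distribˡ _ _ _)) (+-mono-≤ lo lo′) ,
    ≤-respʳ (ℝ.sym (ℝ.distribˡ _ _ _)) (+-mono-≤ hi hi′)

  -- Nonnegativity of w keeps the direction of both inequalities. Here w will be α! f_α.
  approximates-* : ∀ {ε N z w} → IsNonNegative w → Approximates ε N z → Approximates ε (N * w) (z * w)
  approximates-* {ε} {N} {z} {w} (w-real , 0≤w) (z-real , lo , hi) =
    *-isReal {z} {w} z-real w-real ,
    ≤-respˡ (scaled _) (≤-respʳ (ℝ.sym (re-* {z} w-real)) (*-monoʳ-≤ 0≤w lo)) ,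
    ≤-respˡ (ℝ.sym (re-* {z} w-real)) (≤-respʳ (scaled _) (*-monoʳ-≤ 0≤w hi))
    where
    scaled : ∀ c → c ℝ.* re N ℝ.* re w ℝ.≈ c ℝ.* re (N * w)
    scaled c = ℝ.trans (ℝ.*-assoc c (re N) (re w)) (ℝ.*-congˡ (ℝ.sym (re-* {N} w-real)))

  approximates-∑ : ∀ {ε} {A : Set} (xs : List A) {M z : A → ℂ} → (∀ x → Approximates ε (M x) (z x)) →
                   Approximates ε (∑ xs M) (∑ xs z)
  approximates-∑ []       p =
    ℝ.refl , ≤-reflexive (ℝ.zeroʳ _) , ≤-reflexive (ℝ.sym (ℝ.zeroʳ _))
  approximates-∑ (x ∷ xs) {M} p = approximates-+ {M = M x} {∑ xs M} (p x) (approximates-∑ xs p)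

  -- Unlike in the zero test, the value itself matters, so the factor d! is restored.
  apolarityAlgorithm : ∀ {n} (d r : ℕ) → (Fin r → Vec ℂ n) → NumericAlgorithm n r
  apolarityAlgorithm d r ℓ = ask r ℓ (return (con (d ! · 1#) ⊗ answerSum))

  compute-apolarityAlgorithm : ∀ {n d r} (ℓ : Fin r → Vec ℂ n) (f : Form n d) →
    compute (apolarityAlgorithm d r ℓ) f ≈ d ! · sum (λ i → eval f (ℓ i))
  compute-apolarityAlgorithm {d = d} {r} ℓ f
    with run-ask ⟦_⟧ (eval f) r ℓ (return (con (d ! · 1#) ⊗ answerSum)) []
  ... | m , ρ′ , run≡ , total≈ = begin
    compute (apolarityAlgorithm d r ℓ) f            ≡⟨ run≡ ⟩
    (d ! · 1#) * ⟦ answerSum ⟧ ρ′                        ≈⟨ ×-assoc-* (d !) 1# _ ⟩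
    d ! · (1# * ⟦ answerSum ⟧ ρ′)                        ≈⟨ ×-congʳ (d !) (*-identityˡ _) ⟩
    d ! · ⟦ answerSum ⟧ ρ′                               ≈⟨ ×-congʳ (d !) (≈-trans total≈ (+-identityʳ _)) ⟩
    d ! · sum (λ i → eval f (ℓ i))                   ∎
    where open import Relation.Binary.Reasoning.Setoid setoid

  -- The points decompose a nonnegative g′ with the support of g: the zero test answers for g′, and
  -- equality of supports carries the answer over to g.
  nonNegative-decision : ∀ {n d} (g : Form n d) r → IsNonNegativeSupportRank g r →
    ∃ λ (𝒜 : DecisionAlgorithm n r) → (f : Form n d) → NonNegativeForm f →
      (decide 𝒜 f ≡ disjoint) ⇔ Empty (supp g ∩ supp f)
  nonNegative-decision g r ((g′ , g′≥0 , (g′⊆g , g⊆g′) , (ℓ , g′≈) , _) , _) =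
    zeroTest r ℓ , λ f f≥0 →
      let open Equivalence in mk⇔
        (λ eq α (α∈g , α∈f) →
          to (⟨∂⟩-zero⇔ g′ f g′≥0 f≥0)
            (to (waring-sum-zero⇔ g′ f ℓ g′≈) (to (decide-zeroTest ℓ f) eq)) α (α∈f , g⊆g′ α∈g))
        (λ empty → from (decide-zeroTest ℓ f) (from (waring-sum-zero⇔ g′ f ℓ g′≈)
          (from (⟨∂⟩-zero⇔ g′ f g′≥0 f≥0) λ α (α∈f , α∈g′) → empty α (g′⊆g α∈g′ , α∈f))))

  approximation : ∀ {n d} (g : Form n d) ε r → IsApproximateSupportRank ε g r →
    ∃ λ (𝒜 : NumericAlgorithm n r) → (f : Form n d) → NonNegativeForm f →
      Approximates ε (g ⟨∂⟩ f) (compute 𝒜 f)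
  approximation {n} {d} g ε r ((g′ , _ , g′-approx , (ℓ , g′≈) , _) , _) =
    -- The target is expanded into terms of g and the output into terms of g′; these are compared
    -- one exponent at a time.
    apolarityAlgorithm d r ℓ , λ f f≥0 → approximates-resp
      (≈-sym (⟨∂⟩-∑ g f))
      (≈-trans (≈-sym (⟨∂⟩-∑ g′ f))
        (≈-trans (≈-sym (apolarity g′ f ℓ g′≈)) (≈-sym (compute-apolarityAlgorithm ℓ f))))
      (approximates-∑ (monomials n d) λ α →
        approximates-* {z = coeff g′ α} (nonNeg-· (α !ᵛ) (f≥0 α)) (g′-approx α))

  -- Randomized certification

  point : ∀ {m} → Fin m → ℂ
  point ω = fromℝ (ℝ.fromℕ (toℕ ω))

  point-injective : ∀ {m} {ω ω′ : Fin m} → point ω ≈ point ω′ → ω ≡ ω′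
  point-injective (eq , _) = Fin.toℕ-injective (fromℕ-injective eq)

  -- Querying f at the moved points amounts to querying the rescaled form at the original ones, so a
  -- seed reports disjointness exactly at a root of the polynomial in s.
  zeroTest-kronecker : ∀ {n d r} (g f : Form n d) (ℓ : Fin r → Vec ℂ n) s →
    coeff g Ser.≈ SerDefs.sum (λ i → linearForm (ℓ i) SerDefs.^ d) →
    decide (zeroTest r (λ i → Vec.zipWith _*_ (kronecker n d s) (ℓ i))) f ≡ disjoint ⇔
    horner (List.map (term g f) (box n d)) s ≈ 0#
  zeroTest-kronecker {n} {d} {r} g f ℓ s g≈ = mk⇔
    (λ eq → ≈-trans (≈-sym (⟨∂⟩-rescale g f s))
      (to (waring-sum-zero⇔ g fₛ ℓ g≈) (≈-trans evals (to (decide-zeroTest ℓₛ f) eq))))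
    (λ eq → from (decide-zeroTest ℓₛ f) (≈-trans (≈-sym evals)
      (from (waring-sum-zero⇔ g fₛ ℓ g≈) (≈-trans (⟨∂⟩-rescale g f s) eq))))
    where
    open Equivalence
    fₛ = rescale (kronecker n d s) f
    ℓₛ : Fin r → Vec ℂ n
    ℓₛ i = Vec.zipWith _*_ (kronecker n d s) (ℓ i)
    evals : sum (λ i → eval fₛ (ℓ i)) ≈ sum (λ i → eval f (ℓₛ i))
    evals = sum-cong-≋ {r} (λ i → eval-rescale (kronecker n d s) f (ℓ i))

  -- The m seeds split into successes and failures, and failures ≤ b ≤ m δ. The term δ m is added to
  -- both sides to avoid subtraction.
  probability-bound : ∀ {m} (E : Pred (Fin m) 0ℓ) {δ} b → ℝ.fromℕ b ℝ.≤ ℝ.fromℕ m ℝ.* δ →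
    length (List.filter (λ ω → ¬? (em {E ω})) (List.allFin m)) ℕ.≤ b →
    ProbabilityAtLeast (ℝ.1# ℝ.- δ) E
  probability-bound {m} E {δ} b b≤mδ failures≤b = +-cancelʳ-≤ (δ ℝ.* M) (begin
    (ℝ.1# ℝ.- δ) ℝ.* M ℝ.+ δ ℝ.* M           ≈⟨ ℝ.distribʳ M _ δ ⟨
    (ℝ.1# ℝ.- δ ℝ.+ δ) ℝ.* M                 ≈⟨ ℝ.*-congʳ (ℝ.trans (ℝ.+-assoc _ _ _)
                                                  (ℝ.trans (ℝ.+-congˡ (ℝ.-‿inverseˡ δ)) (ℝ.+-identityʳ _))) ⟩
    ℝ.1# ℝ.* M                               ≈⟨ ℝ.*-identityˡ M ⟩
    M                                        ≡⟨ cong ℝ.fromℕ split ⟨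
    ℝ.fromℕ (count E ℕ.+ failures)           ≈⟨ ×-homo-+ ℝ.1# (count E) failures ⟩
    ℝ.fromℕ (count E) ℝ.+ ℝ.fromℕ failures   ≲⟨ +-mono-≤ ≤-refl (begin
      ℝ.fromℕ failures  ≲⟨ fromℕ-mono failures≤b ⟩
      ℝ.fromℕ b         ≲⟨ b≤mδ ⟩
      M ℝ.* δ           ≈⟨ ℝ.*-comm M δ ⟩
      δ ℝ.* M           ∎) ⟩
    ℝ.fromℕ (count E) ℝ.+ δ ℝ.* M            ∎)
    where
    open import Relation.Binary.Reasoning.Preorder ≤-preorder
    open import Algebra.Properties.Monoid.Mult ℝ.+-monoid using (×-homo-+)
    M = ℝ.fromℕ m
    failures = length (List.filter (λ ω → ¬? (em {E ω})) (List.allFin m))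
    split : count E ℕ.+ failures ≡ m
    split = ≡.trans (length-filter-split (λ ω → em {E ω}) (List.allFin m)) (List.length-tabulate id)

  not-intersecting : ∀ {v : Verdict} → ¬ (v ≡ intersecting) → v ≡ disjoint
  not-intersecting {disjoint}     _ = refl
  not-intersecting {intersecting} ≢ = contradiction refl ≢

  randomized-certification : ∀ {n d} (g : Form n d) δ → ℝ.0# ℝ.< δ → ∀ r → IsSupportRank g r →
    ∃ λ (𝒜 : RandomizedAlgorithm n r) → CertifiesSupportIntersection g δ 𝒜
  randomized-certification {n} {d} g δ 0<δ r ((g′ , (g′⊆g , g⊆g′) , (ℓ , g′≈) , _) , _) =
    𝒜 , λ f → disjoint-case f , intersecting-case f
    where
    open Equivalence
    -- The number of coefficients of the polynomial in s, which a nonzero polynomial must exceed in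
    -- no list of distinct roots.
    b = length (box n d)
    m = proj₁ (archimedean em 0<δ (ℝ.fromℕ b))
    -- One seed more than the Archimedean bound asks for, so that the seed set is nonempty even when
    -- that bound is 0.
    b≤mδ : ℝ.fromℕ b ℝ.≤ ℝ.fromℕ (suc m) ℝ.* δ
    b≤mδ = ≤-trans (proj₂ (archimedean em 0<δ (ℝ.fromℕ b)))
                   (*-monoʳ-≤ (proj₁ 0<δ) (fromℕ-mono (ℕ.n≤1+n m)))

    𝒜 : RandomizedAlgorithm n r
    𝒜 = record
      { seeds         = suc m
      ; seeds-nonZero = _
      ; algorithm     = λ ω → zeroTest r λ i → Vec.zipWith _*_ (kronecker n d (point ω)) (ℓ i)
      }

    disjoint-case : ∀ f → Empty (supp f ∩ supp g) → ∀ ω → decide (algorithm 𝒜 ω) f ≡ disjoint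
    disjoint-case f empty ω = from (zeroTest-kronecker g′ f ℓ (point ω) g′≈)
      (horner-zeros (point ω) (All.map⁺ (All.universal
        (term-zero g′ f λ α (α∈f , α∈g′) → empty α (α∈f , g′⊆g α∈g′)) (box n d))))

    intersecting-case : ∀ f → Satisfiable (supp f ∩ supp g) →
      ProbabilityAtLeast (ℝ.1# ℝ.- δ) λ ω → decide (algorithm 𝒜 ω) f ≡ intersecting
    -- If more than b seeds failed, their points would be at least b distinct roots, and all
    -- coefficients would vanish, including the one at the common exponent α.
    intersecting-case f (α , α∈f , α∈g) = probability-bound Detected b b≤mδ (ℕ.≮⇒≥ λ b<failures →
      term-nonzero g′ f (α∈f , g⊆g′ α∈g) (All.lookup (All.map⁻
        (many-roots⇒zero ℂ-*-cancel-≉0 (List.map (term g′ f) (box n d))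
          (ℕ.≤-trans (ℕ.≤-reflexive (List.length-map (term g′ f) (box n d)))
            (ℕ.≤-trans (ℕ.<⇒≤ b<failures) (ℕ.≤-reflexive (≡.sym (List.length-map point failing)))))
          (AllPairs.map⁺ (AllPairs.map (λ ω≢ → ω≢ ∘ point-injective)
            (Unique.filter⁺ failed? (Unique.allFin⁺ (suc m)))))
          (All.map⁺ (All.map (λ {ω} ¬detected →
              to (zeroTest-kronecker g′ f ℓ (point ω) g′≈) (not-intersecting ¬detected))
            (All.all-filter failed? (List.allFin (suc m)))))))
        (∈-box (supp⇒degree f α∈f))))
      where
      Detected : Pred (Fin (suc m)) 0ℓ
      Detected ω = decide (algorithm 𝒜 ω) f ≡ intersecting
      failed? = λ ω → ¬? (em {Detected ω})
      failing = List.filter failed? (List.allFin (suc m))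

proposition22 : (em : ExcludedMiddle 0ℓ) (real : CompleteOrderedField) →
    let open Theory em real in
    (n d : ℕ) →
    ((g : Form n d) (δ : ℝ) → ℝ.0# ℝ.< δ → δ ℝ.< ℝ.1# →
    (r : ℕ) → IsSupportRank g r →
    ∃ λ (𝒜 : RandomizedAlgorithm n r) → CertifiesSupportIntersection g δ 𝒜)
    × ((g : Form n d) (r : ℕ) → IsNonNegativeSupportRank g r →
    ∃ λ (𝒜 : DecisionAlgorithm n r) →
    (f : Form n d) → NonNegativeForm f →
    (decide 𝒜 f ≡ disjoint) ⇔ Empty (supp g ∩ supp f))
    × ((g : Form n d) → NonNegativeForm g →
    (ε : ℝ) → ℝ.0# ℝ.≤ ε → ε ℝ.< ℝ.1# →
    (r : ℕ) → IsApproximateSupportRank ε g r →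
    ∃ λ (𝒜 : NumericAlgorithm n r) →
    (f : Form n d) → NonNegativeForm f → Approximates ε (g ⟨∂⟩ f) (compute 𝒜 f))
proposition22 em real n d =
  (λ g δ 0<δ _ r → randomized-certification g δ 0<δ r) ,
  nonNegative-decision ,
  (λ g _ ε _ _ r → approximation g ε r)
  where open Algorithms em real
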